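{- Let $n\ge2$ be an integer. (a) The expected number of comparisons of strategy ``Clairvoyant'' in one partitioning step on $n$ elements is $$\mathbb{E}(P^{\mathrm{cv}}_n)=\frac32n-\frac94+\frac{1}{4(n-[n\text{ even}])}-\mathbb{E}(X^{\searrow}_n).$$ (b) The expected number of comparisons of strategy ``Count'' in one partitioning step on $n$ elements is $$\mathbb{E}(P^{\mathrm{ct}}_n)=\frac32n-\frac94+\frac{1}{4(n-[n\text{ even}])}+\mathbb{E}(X^{\nearrow}_n).$$
   Context: $[\mathit{expr}]$ is $1$ if $\mathit{expr}$ is true and $0$ otherwise. Partitioning step: the input $(a_1,\dots,a_n)$ is a uniformly random permutation of $\{1,\dots,n\}$, $n\ge2$. One comparison of $a_1$ and $a_n$ determines the pivots $p=\min(a_1,a_n)$ and $q=\max(a_1,a_n)$; this comparison is counted. The remaining elements $a_2,\dots,a_{n-1}$ are classified one after another as small ($<p$), medium (between $p$ and $q$) or large ($>q$). Each element is compared first with one of the two pivots, as prescribed by the strategy, and then with the other pivot exactly if its class is not yet determined (so medium elements always cost 2 comparisons, small elements cost 1 if compared with $p$ first and 2 otherwise, large elements cost 1 if compared with $q$ first and 2 otherwise). Let $s_i$, $\ell_i$ be the numbers of elements classified as small, respectively large, among the first $i$ classified elements ($s_0=\ell_0=0$), and let $s=p-1$, $\ell=n-q$ be the total numbers of small and large elements. When classifying the $i$th element, $1\le i\le n-2$: - Strategy ``Clairvoyant'' (which knows $s$ and $\ell$ from an oracle): if $s-s_{i-1}\ge\ell-\ell_{i-1}$, compare with $p$ first,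 otherwise compare with $q$ first. - Strategy ``Count'': if $s_{i-1}\ge\ell_{i-1}$, compare with $p$ first, otherwise compare with $q$ first. $P^{\mathrm{cv}}_n$ and $P^{\mathrm{ct}}_n$ are the (random) total numbers of comparisons in the partitioning step (without recursive calls) of ``Clairvoyant'' and ``Count'', respectively. Random lattice paths: a random path of length $n'\ge 0$ on $\mathbb{Z}^2$ with steps $(1,+1)$ and $(1,-1)$ is chosen by first choosing a starting point $(0,S)$ with $S$ uniform in $\{ -n',-n'+2,\dots,n'\}$ and then choosing a path uniformly at random among all paths from $(0,S)$ to $(n',0)$. For fixed $n\ge2$, choose $(P,Q)$ with $1\le P<Q\le n$ uniformly at random, let $N'=n-1-(Q-P)$, and choose a random path of length $N'$ in this way. $X^{\nearrow}_n$ is the number of up-to-zero situations on it, i.e. points $(x,0)$ on the path such that $(x-1,-1)$ is on the path; $X^{\searrow}_n$ is the number of down-from-zero situations, i.e. points $(x,0)$ on the path such that $(x+1,-1)$ is on the path. -}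

module Defs where

open import Data.Bool.Base using (Bool; true; false; if_then_else_)
open import Data.Fin.Base using (toℕ)
open import Data.Integer.Base as ℤ using (ℤ; +_; 0ℤ; 1ℤ; -1ℤ)
import Data.Integer.Properties as ℤₚ
open import Data.List.Base as List using (List; []; _∷_; concatMap; filter; length; foldr; cartesianProduct; applyUpTo)
open import Data.Nat.Base as ℕ using (ℕ; zero; suc; _+_; _*_; _∸_; _≤_; _≤ᵇ_; _<ᵇ_; _⊓_; _⊔_; NonZero; s≤s; z≤n)
open import Data.Nat.Divisibility using (_∣?_)
open import Data.Nat.Properties using (_<?_)
open import Data.Product.Base using (_×_; _,_; map₁; map₂)
open import Data.Rational.Base as ℚ using (ℚ; 0ℚ; 1ℚ)
open import Data.Vec.Base as Vec using (Vec; []; _∷_)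
open import Relation.Nullary.Decidable.Core using (Dec; does; _×-dec_)

-- Iverson bracket.
[_] : ∀ {a} {P : Set a} → Dec P → ℕ
[ P? ] = if does P? then 1 else 0

toℚ : ℕ → ℚ
toℚ k = + k ℚ./ 1

------------------------------------------------------------------------
-- Finitely supported distributions, as lists of weighted outcomes

Dist : Set → Set
Dist A = List (ℚ × A)

infixl 1 _>>=_

return : ∀ {A} → A → Dist A
return a = (1ℚ , a) ∷ []

_>>=_ : ∀ {A B} → Dist A → (A → Dist B) → Dist B
d >>= k = concatMap (λ (w , a) → List.map (map₁ (w ℚ.*_)) (k a)) d

-- The list must be non-empty and free of repetitions for this to be the
-- uniform distribution on its elements; every use below is of that kind
-- when n ≥ 2.
uniform : ∀ {A} → List A → Dist A
uniform []       = []
uniform (x ∷ xs) = List.map (+ 1 ℚ./ suc (length xs) ,_) (x ∷ xs)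

𝔼 : Dist ℕ → ℚ
𝔼 = foldr (λ (w , k) e → w ℚ.* toℚ k ℚ.+ e) 0ℚ

------------------------------------------------------------------------
-- Permutations

-- All ways of removing one entry, paired with what remains.
picks : ∀ {A : Set} {n} → Vec A (suc n) → List (A × Vec A n)
picks {n = zero}  (x ∷ []) = (x , []) ∷ []
picks {n = suc _} (x ∷ xs) = (x , xs) ∷ List.map (map₂ (x ∷_)) (picks xs)

permutations : ∀ {A : Set} {n} → Vec A n → List (Vec A n)
permutations {n = zero}  [] = [] ∷ []
permutations {n = suc _} xs =
  concatMap (λ (y , ys) → List.map (y ∷_) (permutations ys)) (picks xs)

randomPermutation : ∀ n → Dist (Vec ℕ n)
randomPermutation n = uniform (permutations (Vec.tabulate λ i → suc (toℕ i)))

------------------------------------------------------------------------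
-- The partitioning step

data Pivot : Set where
  p-first q-first : Pivot

data Class : Set where
  small medium large : Class

-- A strategy gets s, ℓ and then sᵢ₋₁, ℓᵢ₋₁.
Strategy : Set
Strategy = (s ℓ : ℕ) → (sᵢ₋₁ ℓᵢ₋₁ : ℕ) → Pivot

-- The subtractions are exact: sᵢ₋₁ ≤ s and ℓᵢ₋₁ ≤ ℓ throughout a run.
clairvoyant : Strategy
clairvoyant s ℓ sᵢ₋₁ ℓᵢ₋₁ =
  if (ℓ ∸ ℓᵢ₋₁) ≤ᵇ (s ∸ sᵢ₋₁) then p-first else q-first

count : Strategy
count _ _ sᵢ₋₁ ℓᵢ₋₁ = if ℓᵢ₋₁ ≤ᵇ sᵢ₋₁ then p-first else q-first

classify : (p q : ℕ) → ℕ → Class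
classify p q x = if x <ᵇ p then small else if q <ᵇ x then large else medium

cost : Pivot → Class → ℕ
cost p-first small  = 1
cost p-first medium = 2
cost p-first large  = 2
cost q-first small  = 2
cost q-first medium = 2
cost q-first large  = 1

classificationCost : (σ : ℕ → ℕ → Pivot) (sᵢ ℓᵢ : ℕ) → ∀ {m} → Vec Class m → ℕ
classificationCost σ sᵢ ℓᵢ []            = 0
classificationCost σ sᵢ ℓᵢ (small  ∷ cs) = cost (σ sᵢ ℓᵢ) small  + classificationCost σ (suc sᵢ) ℓᵢ cs
classificationCost σ sᵢ ℓᵢ (medium ∷ cs) = cost (σ sᵢ ℓᵢ) medium + classificationCost σ sᵢ ℓᵢ cs
classificationCost σ sᵢ ℓᵢ (large  ∷ cs) = cost (σ sᵢ ℓᵢ) large  + classificationCost σ sᵢ (suc ℓᵢ) cs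

-- The leading 1 is the comparison of a₁ with aₙ.  Inputs with fewer than
-- two elements get a dummy value.
comparisons : Strategy → ∀ {n} → Vec ℕ n → ℕ
comparisons strategy []       = 0
comparisons strategy (_ ∷ []) = 0
comparisons strategy {n} (a₁ ∷ as@(_ ∷ _)) =
  1 + classificationCost (strategy s ℓ) 0 0 (Vec.map (classify p q) (Vec.init as))
  where
  aₙ p q s ℓ : ℕ
  aₙ = Vec.last as
  p  = a₁ ⊓ aₙ
  q  = a₁ ⊔ aₙ
  s  = p ∸ 1
  ℓ  = n ∸ q

P : Strategy → ℕ → Dist ℕ
P strategy n = do
  as ← randomPermutation n
  return (comparisons strategy as)

Pᶜᵛ Pᶜᵗ : ℕ → Dist ℕ
Pᶜᵛ = P clairvoyant
Pᶜᵗ = P count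

------------------------------------------------------------------------
-- Random lattice paths

-- All sequences of n steps, as sequences of height differences ±1.
stepSequences : ∀ n → List (Vec ℤ n)
stepSequences zero    = [] ∷ []
stepSequences (suc n) =
  concatMap (λ ds → (1ℤ ∷ ds) ∷ (-1ℤ ∷ ds) ∷ []) (stepSequences n)

-- A path of length n is represented by its heights at x = 0, …, n.
Path : ℕ → Set
Path n = Vec ℤ (suc n)

follow : ∀ {n} → ℤ → Vec ℤ n → Path n
follow h []       = h ∷ []
follow h (d ∷ ds) = h ∷ follow (h ℤ.+ d) ds

-- All paths from (0, S) to (n, 0).
pathsFrom : ∀ n → ℤ → List (Path n)
pathsFrom n S =
  filter (λ hs → Vec.last hs ℤₚ.≟ 0ℤ) (List.map (follow S) (stepSequences n))

-- -n, -n+2, …, n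
startingHeights : ℕ → List ℤ
startingHeights n = applyUpTo (λ j → + (2 * j) ℤ.- + n) (suc n)

randomPath : ∀ n → Dist (Path n)
randomPath n = do
  S ← uniform (startingHeights n)
  uniform (pathsFrom n S)

-- The number of x such that the heights at x and x + 1 are a and b.
occurrences : (a b : ℤ) → ∀ {n} → Vec ℤ n → ℕ
occurrences a b []            = 0
occurrences a b (_ ∷ [])      = 0
occurrences a b (h ∷ h′ ∷ hs) =
  [ (h ℤₚ.≟ a) ×-dec (h′ ℤₚ.≟ b) ] + occurrences a b (h′ ∷ hs)

upToZero downFromZero : ∀ {n} → Path n → ℕ
upToZero     = occurrences -1ℤ 0ℤ
downFromZero = occurrences 0ℤ -1ℤ

-- All (P , Q) with 1 ≤ P < Q ≤ n.
pivotPairs : ℕ → List (ℕ × ℕ)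
pivotPairs n = filter (λ (P , Q) → P <? Q) (cartesianProduct 1⋯n 1⋯n)
  where
  1⋯n : List ℕ
  1⋯n = applyUpTo suc n

X : (∀ {n′} → Path n′ → ℕ) → ℕ → Dist ℕ
X situations n = do
  (P , Q) ← uniform (pivotPairs n)
  path    ← randomPath (n ∸ 1 ∸ (Q ∸ P))
  return (situations path)

X↗ X↘ : ℕ → Dist ℕ
X↗ = X upToZero
X↘ = X downFromZero

------------------------------------------------------------------------

denominator-nonZero : ∀ {n} → 2 ≤ n → NonZero (4 * (n ∸ [ 2 ∣? n ]))
denominator-nonZero {n} (s≤s (s≤s z≤n)) with does (2 ∣? n)
... | true  = _
... | false = _

{-# OPTIONS --safe #-}
module Submission where

-- Let s and ℓ count the small and large elements that are still to come
-- (Clairvoyant) or have been seen (Count). Classifying a small or large element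
-- takes a second comparison exactly when min(s, ℓ) changes, except when s - ℓ
-- moves between 0 and -1: there Clairvoyant saves a comparison on a step down
-- from 0, and Count wastes one on what is, backwards in time, a step up to 0.
-- Medium elements always cost 2 and leave s and ℓ alone. Hence the mean cost is
-- n - 1 + E(medium) + E(min(s, ℓ)), minus or plus a mean number of crossings.
-- In random order s - ℓ performs a uniformly random lattice path: for Clairvoyant
-- this follows by choosing the first element of a random permutation first, for
-- Count by choosing the last one first. Grouping the pivots by s + ℓ makes both
-- expectations range over the same pairs (s, ℓ).

open import Defs
open import Data.Empty using (⊥-elim)
open import Data.Fin.Base using (toℕ)
open import Data.Bool.Base using (Bool; true; false; if_then_else_)
open import Data.Integer.Base as ℤ using (ℤ; +_; 0ℤ; 1ℤ; -1ℤ)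
import Data.Integer.Properties as ℤₚ
import Data.Integer.Tactic.RingSolver as ℤ-Solver
open import Data.List.Base as List using (List; []; _∷_; _++_; concatMap; filter; length; applyUpTo; cartesianProduct)
open import Data.List.Relation.Unary.All as All using (All; []; _∷_)
import Data.List.Relation.Unary.All.Properties as Allₚ
import Data.List.Properties as Listₚ
open import Data.Nat.Base as ℕ using (ℕ; zero; suc; pred; _≤_; _<_; _∸_; _⊓_; _⊔_; _≤ᵇ_; _<ᵇ_; _!; NonZero; s≤s; z≤n)
open import Data.Nat.Divisibility using (_∣_; _∣?_; divides; ∣m+n∣m⇒∣n; ∣1⇒≡1)
import Data.Nat.Properties as ℕₚ
import Data.Nat.Tactic.RingSolver as ℕ-Solver
open import Data.Product.Base using (_×_; _,_; map₂; proj₁; ∃; ∃₂)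
open import Data.Rational.Base using (ℚ; 0ℚ; 1ℚ; ½; _/_; _+_; _-_; _*_; -_; toℚᵘ)
import Data.Rational.Properties as ℚₚ
open import Data.Rational.Unnormalised.Base as ℚᵘ using (mkℚᵘ; *≡*)
import Data.Rational.Unnormalised.Properties as ℚᵘₚ
open import Data.Sum.Base using (_⊎_; inj₁; inj₂)
open import Data.Vec.Base as Vec using (Vec; []; _∷_; _∷ʳ_)
import Data.Vec.Properties as Vecₚ
open import Function.Base using (_∘_; const)
open import Relation.Binary.Definitions using (tri<; tri≈; tri>)
open import Relation.Binary.PropositionalEquality using (_≡_; _≢_; refl; sym; trans; cong; cong₂; subst; subst₂; module ≡-Reasoning)
open import Relation.Nullary.Decidable using (dec-true; dec-false; Dec; yes; no; does; dec⇒maybe; _×-dec_)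
open import Relation.Nullary.Reflects using (ofʸ; ofⁿ)
open import Relation.Nullary.Negation using (¬_)
open import Tactic.RingSolver using (solve-∀)
open import Tactic.RingSolver.Core.AlmostCommutativeRing using (AlmostCommutativeRing; fromCommutativeRing)

open ≡-Reasoning

private variable
  A B : Set
  n : ℕ

-- Orders of elements and lattice paths are not matched one by one. `IsWalkMean` isolates the linear
-- recursion that both averages obey: from counts `s` and `l`, a small element (a step down) comes
-- next with weight `s`, a large element (a step up) with weight `l`. The mean over orders is
-- evaluated in terms of any solution of this recursion, and the path means are shown to be one. To
-- keep division out of the inductions, means are multiplied by the number of outcomes: sums over
-- orders carry n!, and sums over paths are weighted by s! l!. The law of the random path fits
-- because exactly k + 1 pivot pairs leave k elements outside the pivots, as many as there are
-- starting heights for length k; averaging over pivots and averaging over starting heights are thus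
-- the same average over (s, l).

ℚ-ring : AlmostCommutativeRing _ _
ℚ-ring = fromCommutativeRing ℚₚ.+-*-commutativeRing λ x → dec⇒maybe (0ℚ ℚₚ.≟ x)

-- The embedding of ℕ into ℚ

toℚᵘ-toℚ : ∀ a → toℚᵘ (toℚ a) ℚᵘ.≃ mkℚᵘ (+ a) 0
toℚᵘ-toℚ a = ℚₚ.toℚᵘ-fromℚᵘ (mkℚᵘ (+ a) 0)

toℚ-+ : ∀ a b → toℚ (a ℕ.+ b) ≡ toℚ a + toℚ b
toℚ-+ a b = ℚₚ.toℚᵘ-injective
  (ℚᵘₚ.≃-trans (toℚᵘ-toℚ (a ℕ.+ b))
  (ℚᵘₚ.≃-trans (*≡* (cong (ℤ._* + 1) (cong₂ ℤ._+_ (sym (ℤₚ.*-identityʳ (+ a))) (sym (ℤₚ.*-identityʳ (+ b))))))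
  (ℚᵘₚ.≃-sym (ℚᵘₚ.≃-trans (ℚₚ.toℚᵘ-homo-+ (toℚ a) (toℚ b))
                          (ℚᵘₚ.+-cong (toℚᵘ-toℚ a) (toℚᵘ-toℚ b))))))

toℚ-* : ∀ a b → toℚ (a ℕ.* b) ≡ toℚ a * toℚ b
toℚ-* a b = ℚₚ.toℚᵘ-injective
  (ℚᵘₚ.≃-trans (toℚᵘ-toℚ (a ℕ.* b))
  (ℚᵘₚ.≃-trans (*≡* (cong (ℤ._* + 1) (ℤₚ.pos-* a b)))
  (ℚᵘₚ.≃-sym (ℚᵘₚ.≃-trans (ℚₚ.toℚᵘ-homo-* (toℚ a) (toℚ b))
                          (ℚᵘₚ.*-cong (toℚᵘ-toℚ a) (toℚᵘ-toℚ b))))))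

toℚ-suc : ∀ a → toℚ (suc a) ≡ 1ℚ + toℚ a
toℚ-suc a = toℚ-+ 1 a

toℚ-inverse : ∀ d .{{_ : NonZero d}} → toℚ d * (+ 1 / d) ≡ 1ℚ
toℚ-inverse (suc d) = ℚₚ.toℚᵘ-injective
  (ℚᵘₚ.≃-trans (ℚₚ.toℚᵘ-homo-* (toℚ (suc d)) (+ 1 / suc d))
  (ℚᵘₚ.≃-trans (ℚᵘₚ.*-cong (toℚᵘ-toℚ (suc d)) (ℚₚ.toℚᵘ-fromℚᵘ (mkℚᵘ (+ 1) d)))
               (*≡* (identity (+ suc d)))))
  where
  identity : ∀ x → (x ℤ.* + 1) ℤ.* + 1 ≡ + 1 ℤ.* (+ 1 ℤ.* x)
  identity = ℤ-Solver.solve-∀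

toℚ-*-cancelˡ : ∀ d .{{_ : NonZero d}} {x y} → toℚ d * x ≡ toℚ d * y → x ≡ y
toℚ-*-cancelˡ d {x} {y} eq = begin
  x                         ≡⟨ unit x ⟨
  (+ 1 / d) * (toℚ d * x)   ≡⟨ cong ((+ 1 / d) *_) eq ⟩
  (+ 1 / d) * (toℚ d * y)   ≡⟨ unit y ⟩
  y                         ∎
  where
  assoc-comm : ∀ i t z → i * (t * z) ≡ t * i * z
  assoc-comm = solve-∀ ℚ-ring

  unit : ∀ z → (+ 1 / d) * (toℚ d * z) ≡ z
  unit z = begin
    (+ 1 / d) * (toℚ d * z)   ≡⟨ assoc-comm (+ 1 / d) (toℚ d) z ⟩
    toℚ d * (+ 1 / d) * z     ≡⟨ cong (_* z) (toℚ-inverse d) ⟩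
    1ℚ * z                    ≡⟨ ℚₚ.*-identityˡ z ⟩
    z                         ∎

-- Sums over lists

∑ : List A → (A → ℚ) → ℚ
∑ []       f = 0ℚ
∑ (x ∷ xs) f = f x + ∑ xs f

∑-cong-All : ∀ {f g : A → ℚ} {xs} → All (λ x → f x ≡ g x) xs → ∑ xs f ≡ ∑ xs g
∑-cong-All []         = refl
∑-cong-All (eq ∷ eqs) = cong₂ _+_ eq (∑-cong-All eqs)

∑-cong : ∀ {f g : A → ℚ} xs → (∀ x → f x ≡ g x) → ∑ xs f ≡ ∑ xs g
∑-cong xs eq = ∑-cong-All (All.universal eq xs)

∑-++ : ∀ (xs ys : List A) {f} → ∑ (xs ++ ys) f ≡ ∑ xs f + ∑ ys f
∑-++ []       ys     = sym (ℚₚ.+-identityˡ _)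
∑-++ (x ∷ xs) ys {f} = trans (cong (_+_ (f x)) (∑-++ xs ys)) (sym (ℚₚ.+-assoc (f x) _ _))

∑-map : ∀ (g : A → B) xs {f} → ∑ (List.map g xs) f ≡ ∑ xs (f ∘ g)
∑-map g []           = refl
∑-map g (x ∷ xs) {f} = cong (_+_ (f (g x))) (∑-map g xs)

∑-concatMap : ∀ (g : A → List B) xs {f} → ∑ (concatMap g xs) f ≡ ∑ xs (λ x → ∑ (g x) f)
∑-concatMap g []       = refl
∑-concatMap g (x ∷ xs) = trans (∑-++ (g x) (concatMap g xs)) (cong (_+_ (∑ (g x) _)) (∑-concatMap g xs))

+-interchange : ∀ a b c d → (a + b) + (c + d) ≡ (a + c) + (b + d)
+-interchange = solve-∀ ℚ-ring

∑-distrib-+ : ∀ xs {f g : A → ℚ} → ∑ xs (λ x → f x + g x) ≡ ∑ xs f + ∑ xs g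
∑-distrib-+ []               = refl
∑-distrib-+ (x ∷ xs) {f} {g} =
  trans (cong (_+_ (f x + g x)) (∑-distrib-+ xs)) (+-interchange (f x) (g x) (∑ xs f) (∑ xs g))

*-distribˡ-∑ : ∀ c xs {f : A → ℚ} → c * ∑ xs f ≡ ∑ xs (λ x → c * f x)
*-distribˡ-∑ c []           = ℚₚ.*-zeroʳ c
*-distribˡ-∑ c (x ∷ xs) {f} =
  trans (ℚₚ.*-distribˡ-+ c (f x) (∑ xs f)) (cong (_+_ (c * f x)) (*-distribˡ-∑ c xs))

∑-const : ∀ (xs : List A) c → ∑ xs (const c) ≡ toℚ (length xs) * c
∑-const []       c = sym (ℚₚ.*-zeroˡ c)
∑-const (x ∷ xs) c = begin
  c + ∑ xs (const c)               ≡⟨ cong (_+_ c) (∑-const xs c) ⟩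
  c + toℚ (length xs) * c          ≡⟨ factor c (toℚ (length xs)) ⟩
  (1ℚ + toℚ (length xs)) * c       ≡⟨ cong (_* c) (toℚ-suc (length xs)) ⟨
  toℚ (suc (length xs)) * c        ∎
  where
  factor : ∀ c k → c + k * c ≡ (1ℚ + k) * c
  factor = solve-∀ ℚ-ring

∑-filter : ∀ {P : A → Set} (P? : ∀ x → Dec (P x)) xs {f} →
           ∑ (filter P? xs) f ≡ ∑ xs (λ x → if does (P? x) then f x else 0ℚ)
∑-filter P? []           = refl
∑-filter P? (x ∷ xs) {f} with does (P? x)
... | true  = cong (_+_ (f x)) (∑-filter P? xs)
... | false = trans (∑-filter P? xs) (sym (ℚₚ.+-identityˡ _))

∑-cartesianProduct : ∀ (xs : List A) (ys : List B) {f} →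
                     ∑ (cartesianProduct xs ys) f ≡ ∑ xs (λ x → ∑ ys (λ y → f (x , y)))
∑-cartesianProduct []       ys     = refl
∑-cartesianProduct (x ∷ xs) ys {f} =
  trans (∑-++ (List.map (x ,_) ys) _) (cong₂ _+_ (∑-map (x ,_) ys) (∑-cartesianProduct xs ys))

-- Sums over initial segments of ℕ

∑< : ℕ → (ℕ → ℚ) → ℚ
∑< zero    f = 0ℚ
∑< (suc n) f = f 0 + ∑< n (f ∘ suc)

∑-applyUpTo : ∀ (g : ℕ → A) n {f} → ∑ (applyUpTo g n) f ≡ ∑< n (f ∘ g)
∑-applyUpTo g zero        = refl
∑-applyUpTo g (suc n) {f} = cong (_+_ (f (g 0))) (∑-applyUpTo (g ∘ suc) n)

∑<-cong : ∀ n {f g : ℕ → ℚ} → (∀ i → i < n → f i ≡ g i) → ∑< n f ≡ ∑< n g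
∑<-cong zero    eq = refl
∑<-cong (suc n) eq = cong₂ _+_ (eq 0 (s≤s z≤n)) (∑<-cong n (λ i i<n → eq (suc i) (s≤s i<n)))

∑<-distrib-+ : ∀ n {f g} → ∑< n (λ i → f i + g i) ≡ ∑< n f + ∑< n g
∑<-distrib-+ zero            = refl
∑<-distrib-+ (suc n) {f} {g} =
  trans (cong (_+_ (f 0 + g 0)) (∑<-distrib-+ n)) (+-interchange (f 0) (g 0) (∑< n (f ∘ suc)) (∑< n (g ∘ suc)))

*-distribˡ-∑< : ∀ c n {f} → c * ∑< n f ≡ ∑< n (λ i → c * f i)
*-distribˡ-∑< c zero        = ℚₚ.*-zeroʳ c
*-distribˡ-∑< c (suc n) {f} =
  trans (ℚₚ.*-distribˡ-+ c (f 0) (∑< n (f ∘ suc))) (cong (_+_ (c * f 0)) (*-distribˡ-∑< c n))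

∑<-last : ∀ n f → ∑< (suc n) f ≡ ∑< n f + f n
∑<-last zero    f = trans (ℚₚ.+-identityʳ (f 0)) (sym (ℚₚ.+-identityˡ (f 0)))
∑<-last (suc n) f = trans (cong (_+_ (f 0)) (∑<-last n (f ∘ suc))) (sym (ℚₚ.+-assoc (f 0) _ (f (suc n))))

-- Indices are paired by `suc (i + j) ≡ n` instead of `j = n ∸ suc i`, so that the induction moves
-- `i` to `suc i`, leaves `j` alone and meets no truncated subtraction.
∑<-reverse : ∀ n {f g} → (∀ i j → suc (i ℕ.+ j) ≡ n → f i ≡ g j) → ∑< n f ≡ ∑< n g
∑<-reverse zero            eq = refl
∑<-reverse (suc n) {f} {g} eq = begin
  f 0 + ∑< n (f ∘ suc)   ≡⟨ cong₂ _+_ (eq 0 n refl) (∑<-reverse n (λ i j p → eq (suc i) j (cong suc p))) ⟩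
  g n + ∑< n g           ≡⟨ ℚₚ.+-comm (g n) (∑< n g) ⟩
  ∑< n g + g n           ≡⟨ ∑<-last n g ⟨
  ∑< (suc n) g           ∎

-- Sums over i < j < n, and sums over antidiagonals

∑<< : ℕ → (ℕ → ℕ → ℚ) → ℚ
∑<< zero    h = 0ℚ
∑<< (suc n) h = ∑< n (λ j → h 0 (suc j)) + ∑<< n (λ i j → h (suc i) (suc j))

∑∕ : (ℕ → ℕ → ℚ) → ℕ → ℚ
∑∕ F zero    = F 0 0
∑∕ F (suc n) = F 0 (suc n) + ∑∕ (F ∘ suc) n

∑∕-cong : ∀ n {F G} → (∀ s l → s ℕ.+ l ≡ n → F s l ≡ G s l) → ∑∕ F n ≡ ∑∕ G n
∑∕-cong zero    eq = eq 0 0 refl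
∑∕-cong (suc n) eq = cong₂ _+_ (eq 0 (suc n) refl) (∑∕-cong n (λ s l p → eq (suc s) l (cong suc p)))

∑∕-distrib-+ : ∀ n {F G} → ∑∕ (λ s l → F s l + G s l) n ≡ ∑∕ F n + ∑∕ G n
∑∕-distrib-+ zero            = refl
∑∕-distrib-+ (suc n) {F} {G} =
  trans (cong (_+_ (F 0 (suc n) + G 0 (suc n))) (∑∕-distrib-+ n))
        (+-interchange (F 0 (suc n)) (G 0 (suc n)) (∑∕ (F ∘ suc) n) (∑∕ (G ∘ suc) n))

*-distribˡ-∑∕ : ∀ c n {F} → c * ∑∕ F n ≡ ∑∕ (λ s l → c * F s l) n
*-distribˡ-∑∕ c zero        = refl
*-distribˡ-∑∕ c (suc n) {F} =
  trans (ℚₚ.*-distribˡ-+ c (F 0 (suc n)) (∑∕ (F ∘ suc) n)) (cong (_+_ (c * F 0 (suc n))) (*-distribˡ-∑∕ c n))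

∑∕-const : ∀ n c → ∑∕ (λ _ _ → c) n ≡ toℚ (suc n) * c
∑∕-const zero    c = sym (ℚₚ.*-identityˡ c)
∑∕-const (suc n) c = begin
  c + ∑∕ (λ _ _ → c) n      ≡⟨ cong (_+_ c) (∑∕-const n c) ⟩
  c + toℚ (suc n) * c       ≡⟨ factor c (toℚ (suc n)) ⟩
  (1ℚ + toℚ (suc n)) * c    ≡⟨ cong (_* c) (toℚ-suc (suc n)) ⟨
  toℚ (suc (suc n)) * c     ∎
  where
  factor : ∀ c k → c + k * c ≡ (1ℚ + k) * c
  factor = solve-∀ ℚ-ring

∑∕-last : ∀ n F → ∑∕ F (suc n) ≡ ∑∕ (λ s l → F s (suc l)) n + F (suc n) 0
∑∕-last zero    F = refl
∑∕-last (suc n) F =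
  trans (cong (_+_ (F 0 (suc (suc n)))) (∑∕-last n (F ∘ suc))) (sym (ℚₚ.+-assoc (F 0 (suc (suc n))) _ _))

∑<-as-∑∕ : ∀ n {f F} → (∀ s l → s ℕ.+ l ≡ n → f s ≡ F s l) → ∑< (suc n) f ≡ ∑∕ F n
∑<-as-∑∕ zero    eq = trans (ℚₚ.+-identityʳ _) (eq 0 0 refl)
∑<-as-∑∕ (suc n) eq = cong₂ _+_ (eq 0 (suc n) refl) (∑<-as-∑∕ n (λ s l p → eq (suc s) l (cong suc p)))

-- The term with first argument 0 is split off every antidiagonal. Antidiagonal 0 has no other term,
-- hence `n ∸ 1`. The result matches the recursion of `∑<<`.
∑<-∑∕ : ∀ n F → ∑< n (∑∕ F) ≡ ∑< n (F 0) + ∑< (n ∸ 1) (∑∕ (F ∘ suc))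
∑<-∑∕ zero    F = refl
∑<-∑∕ (suc n) F =
  trans (cong (_+_ (F 0 0)) (∑<-distrib-+ n)) (sym (ℚₚ.+-assoc (F 0 0) _ _))

-- A pair `i < j` splits the other `n - 2` positions into `i` before, `m` between and `l` after.
-- Since `i` and `l` determine `m`, summing over pairs is summing over all (i, l) with i + l ≤ n -
-- 2.
∑<<-as-∑∕ : ∀ n {h F} → (∀ i m l → suc (suc (i ℕ.+ m ℕ.+ l)) ≡ n → h i (suc (i ℕ.+ m)) ≡ F i l) →
            ∑<< n h ≡ ∑< (n ∸ 1) (∑∕ F)
∑<<-as-∑∕ zero            eq = refl
∑<<-as-∑∕ (suc n) {h} {F} eq = begin
  ∑< n (h 0 ∘ suc) + ∑<< n (λ i j → h (suc i) (suc j))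
    ≡⟨ cong₂ _+_ (∑<-reverse n (λ m l p → eq 0 m l (cong suc p)))
                 (∑<<-as-∑∕ n (λ i m l p → eq (suc i) m l (cong suc p))) ⟩
  ∑< n (F 0) + ∑< (n ∸ 1) (∑∕ (F ∘ suc))
    ≡⟨ ∑<-∑∕ n F ⟨
  ∑< n (∑∕ F) ∎

-- Expectations

𝔼[_] : (A → ℚ) → Dist A → ℚ
𝔼[ f ] d = ∑ d (λ (w , a) → w * f a)

𝔼-toℚ : ∀ d → 𝔼 d ≡ 𝔼[ toℚ ] d
𝔼-toℚ []            = refl
𝔼-toℚ ((w , a) ∷ d) = cong (_+_ (w * toℚ a)) (𝔼-toℚ d)

𝔼-return : ∀ (f : A → ℚ) a → 𝔼[ f ] (return a) ≡ f a
𝔼-return f a = trans (ℚₚ.+-identityʳ _) (ℚₚ.*-identityˡ (f a))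

𝔼->>= : ∀ (f : B → ℚ) (d : Dist A) k → 𝔼[ f ] (d >>= k) ≡ 𝔼[ (λ a → 𝔼[ f ] (k a)) ] d
𝔼->>= f d k = trans (∑-concatMap _ d) (∑-cong d λ (w , a) → begin
  ∑ (List.map _ (k a)) _               ≡⟨ ∑-map _ (k a) ⟩
  ∑ (k a) (λ (u , b) → w * u * f b)    ≡⟨ ∑-cong (k a) (λ (u , b) → ℚₚ.*-assoc w u (f b)) ⟩
  ∑ (k a) (λ (u , b) → w * (u * f b))  ≡⟨ *-distribˡ-∑ w (k a) ⟨
  w * ∑ (k a) (λ (u , b) → u * f b)    ∎)

𝔼-cong : ∀ {f g : A → ℚ} d → (∀ a → f a ≡ g a) → 𝔼[ f ] d ≡ 𝔼[ g ] d
𝔼-cong d eq = ∑-cong d (λ (w , a) → cong (w *_) (eq a))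

-- Multiplying by the length removes the division and covers the empty list, where both sides are 0.
𝔼-uniform : ∀ (f : A → ℚ) xs → toℚ (length xs) * 𝔼[ f ] (uniform xs) ≡ ∑ xs f
𝔼-uniform f []           = refl
𝔼-uniform f xs@(_ ∷ xs′) = begin
  toℚ ∣xs∣ * 𝔼[ f ] (uniform xs)              ≡⟨ cong (toℚ ∣xs∣ *_) (∑-map ((+ 1 / ∣xs∣) ,_) xs {λ (w , a) → w * f a}) ⟩
  toℚ ∣xs∣ * ∑ xs (λ x → (+ 1 / ∣xs∣) * f x)   ≡⟨ cong (toℚ ∣xs∣ *_) (*-distribˡ-∑ (+ 1 / ∣xs∣) xs) ⟨
  toℚ ∣xs∣ * ((+ 1 / ∣xs∣) * ∑ xs f)           ≡⟨ ℚₚ.*-assoc (toℚ ∣xs∣) (+ 1 / ∣xs∣) (∑ xs f) ⟨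
  toℚ ∣xs∣ * (+ 1 / ∣xs∣) * ∑ xs f             ≡⟨ cong (_* ∑ xs f) (toℚ-inverse ∣xs∣) ⟩
  1ℚ * ∑ xs f                                  ≡⟨ ℚₚ.*-identityˡ (∑ xs f) ⟩
  ∑ xs f                                       ∎
  where
  ∣xs∣ : ℕ
  ∣xs∣ = suc (length xs′)

-- Permutations

total : (A → ℕ) → Vec A n → ℕ
total f xs = Vec.sum (Vec.map f xs)

-- Each pair of positions occurs once, in vector order. From an increasing vector the two entries
-- are therefore already the smaller and the larger pivot.
pairs : Vec A (suc (suc n)) → List (A × A × Vec A n)
pairs {n = zero}  (x ∷ y ∷ []) = (x , y , []) ∷ []
pairs {n = suc _} (x ∷ xs)     =
  List.map (λ (y , ys) → x , y , ys) (picks xs) ++ List.map (λ (y , z , zs) → y , z , x ∷ zs) (pairs xs)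

∑-pairs-∷ : ∀ x (xs : Vec A (suc (suc n))) (G : A → A → Vec A (suc n) → ℚ) →
            ∑ (pairs (x ∷ xs)) (λ (y , z , zs) → G y z zs) ≡
            ∑ (picks xs) (λ (y , ys) → G x y ys) + ∑ (pairs xs) (λ (y , z , zs) → G y z (x ∷ zs))
∑-pairs-∷ x xs G = trans (∑-++ (List.map _ (picks xs)) _) (cong₂ _+_ (∑-map _ (picks xs)) (∑-map _ (pairs xs)))

-- Two successive choices reach every pair of positions in both orders. In the induction the head is
-- chosen first, second or not at all; these are `first`, `second` and `rest`.
∑-picks-picks : ∀ (xs : Vec A (suc (suc n))) (G : A → A → Vec A n → ℚ) →
                ∑ (picks xs) (λ (y , ys) → ∑ (picks ys) (λ (z , zs) → G y z zs)) ≡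
                ∑ (pairs xs) (λ (y , z , zs) → G y z zs + G z y zs)
∑-picks-picks {n = zero} (x ∷ y ∷ []) G = simplify (G x y []) (G y x [])
  where
  simplify : ∀ a b → a + 0ℚ + (b + 0ℚ + 0ℚ) ≡ a + b + 0ℚ
  simplify = solve-∀ ℚ-ring
∑-picks-picks {n = suc n} (x ∷ xs) G = begin
  ∑ (picks xs) (λ (y , ys) → G x y ys) + ∑ (List.map (map₂ (x ∷_)) (picks xs)) (λ (y , ys) → ∑ (picks ys) (λ (z , zs) → G y z zs))
    ≡⟨ cong (_+_ first) (∑-map (map₂ (x ∷_)) (picks xs)) ⟩
  first + ∑ (picks xs) (λ (y , ys) → G y x ys + ∑ (List.map (map₂ (x ∷_)) (picks ys)) (λ (z , zs) → G y z zs))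
    ≡⟨ cong (_+_ first) (∑-distrib-+ (picks xs)) ⟩
  first + (second + ∑ (picks xs) (λ (y , ys) → ∑ (List.map (map₂ (x ∷_)) (picks ys)) (λ (z , zs) → G y z zs)))
    ≡⟨ cong (λ t → first + (second + t)) (∑-cong (picks xs) (λ (y , ys) → ∑-map (map₂ (x ∷_)) (picks ys))) ⟩
  first + (second + ∑ (picks xs) (λ (y , ys) → ∑ (picks ys) (λ (z , zs) → G y z (x ∷ zs))))
    ≡⟨ cong (λ t → first + (second + t)) (∑-picks-picks xs (λ y z zs → G y z (x ∷ zs))) ⟩
  first + (second + rest)
    ≡⟨ ℚₚ.+-assoc first second rest ⟨
  first + second + rest
    ≡⟨ cong (_+ rest) (∑-distrib-+ (picks xs)) ⟨
  ∑ (picks xs) (λ (y , ys) → G x y ys + G y x ys) + rest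
    ≡⟨ ∑-pairs-∷ x xs (λ y z zs → G y z zs + G z y zs) ⟨
  ∑ (pairs (x ∷ xs)) (λ (y , z , zs) → G y z zs + G z y zs) ∎
  where
  first second rest : ℚ
  first  = ∑ (picks xs) (λ (y , ys) → G x y ys)
  second = ∑ (picks xs) (λ (y , ys) → G y x ys)
  rest   = ∑ (pairs xs) (λ (y , z , zs) → G y z (x ∷ zs) + G z y (x ∷ zs))

∑-permutations-∷ : ∀ (xs : Vec A (suc n)) F →
                   ∑ (permutations xs) F ≡ ∑ (picks xs) (λ (y , ys) → ∑ (permutations ys) (λ ρ → F (y ∷ ρ)))
∑-permutations-∷ xs F =
  trans (∑-concatMap _ (picks xs)) (∑-cong (picks xs) (λ (y , ys) → ∑-map (y ∷_) (permutations ys)))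

-- `permutations` chooses the first entry first. After that the induction hypothesis chooses the
-- last entry, and the two choices may be exchanged because the right-hand side of `∑-picks-picks`
-- is symmetric in them.
∑-permutations-∷ʳ : ∀ (xs : Vec A (suc n)) F →
                    ∑ (permutations xs) F ≡ ∑ (picks xs) (λ (z , zs) → ∑ (permutations zs) (λ ρ → F (ρ ∷ʳ z)))
∑-permutations-∷ʳ {n = zero}  (x ∷ []) F = sym (ℚₚ.+-identityʳ _)
∑-permutations-∷ʳ {n = suc n} xs       F = begin
  ∑ (permutations xs) F
    ≡⟨ ∑-permutations-∷ xs F ⟩
  ∑ (picks xs) (λ (y , ys) → ∑ (permutations ys) (λ ρ → F (y ∷ ρ)))
    ≡⟨ ∑-cong (picks xs) (λ (y , ys) → ∑-permutations-∷ʳ ys (λ ρ → F (y ∷ ρ))) ⟩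
  ∑ (picks xs) (λ (y , ys) → ∑ (picks ys) (λ (z , zs) → G y z zs))
    ≡⟨ ∑-picks-picks xs G ⟩
  ∑ (pairs xs) (λ (y , z , zs) → G y z zs + G z y zs)
    ≡⟨ ∑-cong (pairs xs) (λ (y , z , zs) → ℚₚ.+-comm (G y z zs) (G z y zs)) ⟩
  ∑ (pairs xs) (λ (z , y , zs) → G y z zs + G z y zs)
    ≡⟨ ∑-picks-picks xs (λ z y zs → G y z zs) ⟨
  ∑ (picks xs) (λ (z , ys) → ∑ (picks ys) (λ (y , zs) → G y z zs))
    ≡⟨ ∑-cong (picks xs) (λ (z , ys) → ∑-permutations-∷ ys (λ ρ → F (ρ ∷ʳ z))) ⟨
  ∑ (picks xs) (λ (z , ys) → ∑ (permutations ys) (λ ρ → F (ρ ∷ʳ z))) ∎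
  where
  G : _ → _ → Vec _ n → ℚ
  G y z zs = ∑ (permutations zs) (λ ρ → F (y ∷ (ρ ∷ʳ z)))

-- The outermost entries become the pivots. Both ways of placing them are summed together because
-- the partitioning step depends only on their minimum and maximum.
∑-permutations-ends : ∀ (xs : Vec A (suc (suc n))) F →
  ∑ (permutations xs) F ≡
  ∑ (pairs xs) (λ (y , z , zs) → ∑ (permutations zs) (λ ρ → F (y ∷ (ρ ∷ʳ z)) + F (z ∷ (ρ ∷ʳ y))))
∑-permutations-ends xs F = begin
  ∑ (permutations xs) F
    ≡⟨ ∑-permutations-∷ xs F ⟩
  ∑ (picks xs) (λ (y , ys) → ∑ (permutations ys) (λ ρ → F (y ∷ ρ)))
    ≡⟨ ∑-cong (picks xs) (λ (y , ys) → ∑-permutations-∷ʳ ys (λ ρ → F (y ∷ ρ))) ⟩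
  ∑ (picks xs) (λ (y , ys) → ∑ (picks ys) (λ (z , zs) → G y z zs))
    ≡⟨ ∑-picks-picks xs G ⟩
  ∑ (pairs xs) (λ (y , z , zs) → G y z zs + G z y zs)
    ≡⟨ ∑-cong (pairs xs) (λ (y , z , zs) → ∑-distrib-+ (permutations zs)) ⟨
  ∑ (pairs xs) (λ (y , z , zs) → ∑ (permutations zs) (λ ρ → F (y ∷ (ρ ∷ʳ z)) + F (z ∷ (ρ ∷ʳ y)))) ∎
  where
  G : _ → _ → Vec _ _ → ℚ
  G y z zs = ∑ (permutations zs) (λ ρ → F (y ∷ (ρ ∷ʳ z)))

∑-picks-map : ∀ (f : A → B) (xs : Vec A (suc n)) {F} →
              ∑ (picks xs) (λ (y , ys) → F (f y , Vec.map f ys)) ≡ ∑ (picks (Vec.map f xs)) F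
∑-picks-map {n = zero}  f (x ∷ [])     = refl
∑-picks-map {n = suc n} f (x ∷ xs) {F} = cong (_+_ (F (f x , Vec.map f xs))) (begin
  ∑ (List.map (map₂ (x ∷_)) (picks xs)) (λ (y , ys) → F (f y , Vec.map f ys))  ≡⟨ ∑-map _ (picks xs) ⟩
  ∑ (picks xs) (λ (y , ys) → F (f y , f x ∷ Vec.map f ys))                     ≡⟨ ∑-picks-map f xs {λ (y , ys) → F (y , f x ∷ ys)} ⟩
  ∑ (picks (Vec.map f xs)) (λ (y , ys) → F (y , f x ∷ ys))                     ≡⟨ ∑-map _ (picks (Vec.map f xs)) ⟨
  ∑ (List.map (map₂ (f x ∷_)) (picks (Vec.map f xs))) F                        ∎)

-- `permutations` never compares entries, so elements of the same class stay distinguishable and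
-- every class sequence keeps its multiplicity. This transfers a uniform order of the elements to
-- their classes.
∑-permutations-map : ∀ (f : A → B) (xs : Vec A n) F →
                     ∑ (permutations xs) (F ∘ Vec.map f) ≡ ∑ (permutations (Vec.map f xs)) F
∑-permutations-map {n = zero}  f [] F = refl
∑-permutations-map {n = suc n} f xs F = begin
  ∑ (permutations xs) (F ∘ Vec.map f)
    ≡⟨ ∑-permutations-∷ xs (F ∘ Vec.map f) ⟩
  ∑ (picks xs) (λ (y , ys) → ∑ (permutations ys) (λ ρ → F (f y ∷ Vec.map f ρ)))
    ≡⟨ ∑-cong (picks xs) (λ (y , ys) → ∑-permutations-map f ys (λ ρ → F (f y ∷ ρ))) ⟩
  ∑ (picks xs) (λ (y , ys) → ∑ (permutations (Vec.map f ys)) (λ ρ → F (f y ∷ ρ)))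
    ≡⟨ ∑-picks-map f xs ⟩
  ∑ (picks (Vec.map f xs)) (λ (y , ys) → ∑ (permutations ys) (λ ρ → F (y ∷ ρ)))
    ≡⟨ ∑-permutations-∷ (Vec.map f xs) F ⟨
  ∑ (permutations (Vec.map f xs)) F ∎

-- Totals and counts that do not depend on the order

+-swap : ∀ a b c → a ℕ.+ (b ℕ.+ c) ≡ b ℕ.+ (a ℕ.+ c)
+-swap = ℕ-Solver.solve-∀

picks-total : ∀ (f : A → ℕ) (xs : Vec A (suc n)) → All (λ (y , ys) → f y ℕ.+ total f ys ≡ total f xs) (picks xs)
picks-total {n = zero}  f (x ∷ []) = refl ∷ []
picks-total {n = suc n} f (x ∷ xs) = refl ∷ Allₚ.map⁺ (All.map (λ {(y , ys)} eq → trans (+-swap (f y) (f x) (total f ys)) (cong (f x ℕ.+_) eq)) (picks-total f xs))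

permutations-total : ∀ (f : A → ℕ) (xs : Vec A n) → All (λ ρ → total f ρ ≡ total f xs) (permutations xs)
permutations-total {n = zero}  f [] = refl ∷ []
permutations-total {n = suc n} f xs = Allₚ.concat⁺ (Allₚ.map⁺ (All.map
  (λ {(y , ys)} eq → Allₚ.map⁺ (All.map (λ eq′ → trans (cong (f y ℕ.+_) eq′) eq) (permutations-total f ys)))
  (picks-total f xs)))

∑-picks-const : ∀ (xs : Vec A (suc n)) c → ∑ (picks xs) (const c) ≡ toℚ (suc n) * c
∑-picks-const xs c = trans (∑-const (picks xs) c) (cong (λ k → toℚ k * c) (length-picks xs))
  where
  length-picks : ∀ {n} (xs : Vec A (suc n)) → length (picks xs) ≡ suc n
  length-picks {n = zero}  (x ∷ []) = refl
  length-picks {n = suc n} (x ∷ xs) = cong suc (trans (Listₚ.length-map _ (picks xs)) (length-picks xs))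

∑-permutations-const : ∀ (xs : Vec A n) c → ∑ (permutations xs) (const c) ≡ toℚ (n !) * c
∑-permutations-const {n = zero}  [] c = trans (ℚₚ.+-identityʳ c) (sym (ℚₚ.*-identityˡ c))
∑-permutations-const {n = suc n} xs c = begin
  ∑ (permutations xs) (const c)                                ≡⟨ ∑-permutations-∷ xs (const c) ⟩
  ∑ (picks xs) (λ (y , ys) → ∑ (permutations ys) (const c))    ≡⟨ ∑-cong (picks xs) (λ (y , ys) → ∑-permutations-const ys c) ⟩
  ∑ (picks xs) (const (toℚ (n !) * c))                         ≡⟨ ∑-picks-const xs _ ⟩
  toℚ (suc n) * (toℚ (n !) * c)                                ≡⟨ ℚₚ.*-assoc (toℚ (suc n)) (toℚ (n !)) c ⟨
  toℚ (suc n) * toℚ (n !) * c                                  ≡⟨ cong (_* c) (toℚ-* (suc n) (n !)) ⟨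
  toℚ (suc n !) * c                                            ∎

length-permutations : ∀ (xs : Vec A n) → toℚ (length (permutations xs)) ≡ toℚ (n !)
length-permutations {n = n} xs = begin
  toℚ (length (permutations xs))        ≡⟨ ℚₚ.*-identityʳ _ ⟨
  toℚ (length (permutations xs)) * 1ℚ   ≡⟨ ∑-const (permutations xs) 1ℚ ⟨
  ∑ (permutations xs) (const 1ℚ)        ≡⟨ ∑-permutations-const xs 1ℚ ⟩
  toℚ (n !) * 1ℚ                        ≡⟨ ℚₚ.*-identityʳ _ ⟩
  toℚ (n !)                             ∎

-- Pairs of entries of an increasing vector

range : (ℕ → A) → ∀ n → Vec A n
range f n = Vec.tabulate (f ∘ toℕ)

∑-picks-range : ∀ (f : ℕ → A) n {K : A → ℚ} → ∑ (picks (range f (suc n))) (K ∘ proj₁) ≡ ∑< (suc n) (K ∘ f)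
∑-picks-range f zero        = refl
∑-picks-range f (suc n) {K} =
  cong (_+_ (K (f 0))) (trans (∑-map _ (picks (range (f ∘ suc) (suc n)))) (∑-picks-range (f ∘ suc) n))

∑-pairs-range : ∀ (f : ℕ → A) n {K : A → A → ℚ} →
                ∑ (pairs (range f (suc (suc n)))) (λ (x , y , _) → K x y) ≡ ∑<< (suc (suc n)) (λ i j → K (f i) (f j))
∑-pairs-range f zero    {K} = simplify (K (f 0) (f 1))
  where
  simplify : ∀ a → a + 0ℚ ≡ (a + 0ℚ) + (0ℚ + 0ℚ)
  simplify = solve-∀ ℚ-ring
∑-pairs-range f (suc n) {K} = trans (∑-pairs-∷ (f 0) (range (f ∘ suc) (suc (suc n))) (λ x y _ → K x y))
  (cong₂ _+_ (∑-picks-range (f ∘ suc) (suc n) {K (f 0)}) (∑-pairs-range (f ∘ suc) n {K}))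

picks-range-All : ∀ (f : ℕ → A) n → All (λ (x , _) → ∃ λ i → i < suc n × x ≡ f i) (picks (range f (suc n)))
picks-range-All f zero    = (0 , s≤s z≤n , refl) ∷ []
picks-range-All f (suc n) = (0 , s≤s z≤n , refl) ∷
  Allₚ.map⁺ (All.map (λ (i , i<n , eq) → suc i , s≤s i<n , eq) (picks-range-All (f ∘ suc) n))

pairs-range-All : ∀ (f : ℕ → A) n →
  All (λ (x , y , _) → ∃₂ λ i j → i < j × j < suc (suc n) × x ≡ f i × y ≡ f j) (pairs (range f (suc (suc n))))
pairs-range-All f zero    = (0 , 1 , s≤s z≤n , s≤s (s≤s z≤n) , refl , refl) ∷ []
pairs-range-All f (suc n) = Allₚ.++⁺
  (Allₚ.map⁺ (All.map (λ (j , j<n , eq) → 0 , suc j , s≤s z≤n , s≤s j<n , refl , eq) (picks-range-All (f ∘ suc) (suc n))))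
  (Allₚ.map⁺ (All.map (λ (i , j , i<j , j<n , eq , eq′) → suc i , suc j , s≤s i<j , s≤s j<n , eq , eq′) (pairs-range-All (f ∘ suc) n)))

pairs-total : ∀ (f : A → ℕ) (xs : Vec A (suc (suc n))) →
              All (λ (y , z , zs) → f y ℕ.+ (f z ℕ.+ total f zs) ≡ total f xs) (pairs xs)
pairs-total {n = zero}  f (x ∷ y ∷ []) = refl ∷ []
pairs-total {n = suc n} f (x ∷ xs)     = Allₚ.++⁺
  (Allₚ.map⁺ (All.map (cong (f x ℕ.+_)) (picks-total f xs)))
  (Allₚ.map⁺ (All.map (λ {(y , z , zs)} eq → trans (swap (f y) (f z) (f x) (total f zs)) (cong (f x ℕ.+_) eq)) (pairs-total f xs)))
  where
  swap : ∀ a b c d → a ℕ.+ (b ℕ.+ (c ℕ.+ d)) ≡ c ℕ.+ (a ℕ.+ (b ℕ.+ d))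
  swap = ℕ-Solver.solve-∀

-- Cost of a class sequence

δ : Class → Class → ℕ
δ small  small  = 1
δ medium medium = 1
δ large  large  = 1
δ _      _      = 0

-- Counting by a `total` makes the counts invariant under `picks` and `permutations` at one stroke.
♯ : Class → Vec Class n → ℕ
♯ c = total (δ c)

♯-total : ∀ (cs : Vec Class n) → ♯ small cs ℕ.+ ♯ medium cs ℕ.+ ♯ large cs ≡ n
♯-total []            = refl
♯-total (small  ∷ cs) = cong suc (♯-total cs)
♯-total (medium ∷ cs) = trans (cong (ℕ._+ ♯ large cs) (ℕₚ.+-suc (♯ small cs) (♯ medium cs))) (cong suc (♯-total cs))
♯-total (large  ∷ cs) = trans (ℕₚ.+-suc _ (♯ large cs)) (cong suc (♯-total cs))

-- Picking a position picks a class with its count as weight. If that count is 0, the value at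
-- `pred` of it is meaningless, but the factor 0 cancels it.
∑-picks-classes : ∀ (cs : Vec Class (suc n)) (g : Class → ℕ → ℕ → ℚ) →
  ∑ (picks cs) (λ (c , cs′) → g c (♯ small cs′) (♯ large cs′)) ≡
    toℚ (♯ small cs) * g small (pred (♯ small cs)) (♯ large cs)
  + toℚ (♯ medium cs) * g medium (♯ small cs) (♯ large cs)
  + toℚ (♯ large cs) * g large (♯ small cs) (pred (♯ large cs))
∑-picks-classes {n = zero} (small  ∷ []) g = simplify (g small 0 0) (g medium 1 0) (g large 1 0)
  where
  simplify : ∀ a b c → a + 0ℚ ≡ 1ℚ * a + 0ℚ * b + 0ℚ * c
  simplify = solve-∀ ℚ-ring
∑-picks-classes {n = zero} (medium ∷ []) g = simplify (g small 0 0) (g medium 0 0) (g large 0 0)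
  where
  simplify : ∀ a b c → b + 0ℚ ≡ 0ℚ * a + 1ℚ * b + 0ℚ * c
  simplify = solve-∀ ℚ-ring
∑-picks-classes {n = zero} (large  ∷ []) g = simplify (g small 0 1) (g medium 0 1) (g large 0 0)
  where
  simplify : ∀ a b c → c + 0ℚ ≡ 0ℚ * a + 0ℚ * b + 1ℚ * c
  simplify = solve-∀ ℚ-ring
∑-picks-classes {n = suc n} (c ∷ cs) g = begin
  g c s l + ∑ (List.map (map₂ (c ∷_)) (picks cs)) (λ (c , cs′) → g c (♯ small cs′) (♯ large cs′))
    ≡⟨ cong (_+_ (g c s l)) (∑-map (map₂ (c ∷_)) (picks cs)) ⟩
  g c s l + ∑ (picks cs) (λ (d , cs′) → g d (δ small c ℕ.+ ♯ small cs′) (δ large c ℕ.+ ♯ large cs′))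
    ≡⟨ cong (_+_ (g c s l)) (∑-picks-classes cs (λ d i j → g d (δ small c ℕ.+ i) (δ large c ℕ.+ j))) ⟩
  g c s l + (toℚ s * g small (δ small c ℕ.+ pred s) (δ large c ℕ.+ l) + toℚ m * g medium (δ small c ℕ.+ s) (δ large c ℕ.+ l)
    + toℚ l * g large (δ small c ℕ.+ s) (δ large c ℕ.+ pred l))
    ≡⟨ insert c ⟩
  _ ∎
  where
  s m l : ℕ
  s = ♯ small cs
  m = ♯ medium cs
  l = ♯ large cs

  suc-pred : ∀ k (f : ℕ → ℚ) → toℚ k * f (suc (pred k)) ≡ toℚ k * f k
  suc-pred zero    f = trans (ℚₚ.*-zeroˡ (f 1)) (sym (ℚₚ.*-zeroˡ (f 0)))
  suc-pred (suc k) f = refl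

  add-small : ∀ a x b c → a + (x * a + b + c) ≡ (1ℚ + x) * a + b + c
  add-small = solve-∀ ℚ-ring

  add-medium : ∀ a x b c → a + (b + x * a + c) ≡ b + (1ℚ + x) * a + c
  add-medium = solve-∀ ℚ-ring

  add-large : ∀ a x b c → a + (b + c + x * a) ≡ b + c + (1ℚ + x) * a
  add-large = solve-∀ ℚ-ring

  insert : ∀ c →
    g c s l + (toℚ s * g small (δ small c ℕ.+ pred s) (δ large c ℕ.+ l) + toℚ m * g medium (δ small c ℕ.+ s) (δ large c ℕ.+ l)
      + toℚ l * g large (δ small c ℕ.+ s) (δ large c ℕ.+ pred l)) ≡
    toℚ (♯ small (c ∷ cs)) * g small (pred (♯ small (c ∷ cs))) (♯ large (c ∷ cs))
      + toℚ (♯ medium (c ∷ cs)) * g medium (♯ small (c ∷ cs)) (♯ large (c ∷ cs))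
      + toℚ (♯ large (c ∷ cs)) * g large (♯ small (c ∷ cs)) (pred (♯ large (c ∷ cs)))
  insert small = begin
    x + (toℚ s * g small (suc (pred s)) l + y + z)   ≡⟨ cong (λ t → x + (t + y + z)) (suc-pred s (λ i → g small i l)) ⟩
    x + (toℚ s * x + y + z)                          ≡⟨ add-small x (toℚ s) y z ⟩
    (1ℚ + toℚ s) * x + y + z                         ≡⟨ cong (λ t → t * x + y + z) (toℚ-suc s) ⟨
    toℚ (suc s) * x + y + z                          ∎
    where
    x y z : ℚ
    x = g small s l
    y = toℚ m * g medium (suc s) l
    z = toℚ l * g large (suc s) (pred l)
  insert medium = begin
    x + (y + toℚ m * x + z)     ≡⟨ add-medium x (toℚ m) y z ⟩
    y + (1ℚ + toℚ m) * x + z    ≡⟨ cong (λ t → y + t * x + z) (toℚ-suc m) ⟨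
    y + toℚ (suc m) * x + z     ∎
    where
    x y z : ℚ
    x = g medium s l
    y = toℚ s * g small (pred s) l
    z = toℚ l * g large s (pred l)
  insert large = begin
    x + (y + z + toℚ l * g large s (suc (pred l)))   ≡⟨ cong (λ t → x + (y + z + t)) (suc-pred l (g large s)) ⟩
    x + (y + z + toℚ l * x)                          ≡⟨ add-large x (toℚ l) y z ⟩
    y + z + (1ℚ + toℚ l) * x                         ≡⟨ cong (λ t → y + z + t * x) (toℚ-suc l) ⟨
    y + z + toℚ (suc l) * x                          ∎
    where
    x y z : ℚ
    x = g large s l
    y = toℚ s * g small (pred s) (suc l)
    z = toℚ m * g medium s (suc l)

-- The means v of a functional that sums weights w along the walk from (s , l)
-- to (0 , 0) which removes one uniformly chosen element at a time.
IsWalkMean : (w : Class → ℕ → ℕ → ℚ) (v : ℕ → ℕ → ℚ) → Set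
IsWalkMean w v = ∀ s l → toℚ s * (w small (pred s) l + v (pred s) l) + toℚ l * (w large s (pred l) + v s (pred l))
                         ≡ toℚ (s ℕ.+ l) * v s l

-- Here `k` is the cost of the element removed, given the counts without it, and `F` is the cost of
-- a sequence. By the hypothesis on `k`, a removal costs 1, plus 1 if medium, plus the drop of
-- `s ⊓ l`, plus `w`. Over a whole run the first three add up to n + m + min(s, l) in every order,
-- while the weights `w` average to `v`. Removing a medium element is an idle step: it has weight
-- `m` and leaves `v` as it is.
∑-permutations-classes : ∀ {w v} → IsWalkMean w v → (∀ s l → w medium s l ≡ 0ℚ) → v 0 0 ≡ 0ℚ →
  (k : Class → ℕ → ℕ → ℕ) →
  (∀ c s l → toℚ (k c s l ℕ.+ s ⊓ l) ≡ toℚ (suc (δ medium c ℕ.+ (δ small c ℕ.+ s) ⊓ (δ large c ℕ.+ l))) + w c s l) →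
  (F : ∀ {n} → Vec Class n → ℕ) → F [] ≡ 0 →
  (∀ {n} (cs : Vec Class (suc n)) → ∑ (permutations cs) (toℚ ∘ F) ≡
     ∑ (picks cs) (λ (c , cs′) → ∑ (permutations cs′) (λ ρ → toℚ (k c (♯ small cs′) (♯ large cs′) ℕ.+ F ρ)))) →
  ∀ (cs : Vec Class n) → ∑ (permutations cs) (toℚ ∘ F) ≡
    toℚ (n !) * (toℚ (n ℕ.+ (♯ medium cs ℕ.+ ♯ small cs ⊓ ♯ large cs)) + v (♯ small cs) (♯ large cs))
∑-permutations-classes {n = zero} {v = v} _ _ v₀₀ k _ F F-[] _ [] = begin
  toℚ (F []) + 0ℚ         ≡⟨ cong (λ t → toℚ t + 0ℚ) F-[] ⟩
  1ℚ * (toℚ 0 + 0ℚ)       ≡⟨ cong (λ t → 1ℚ * (toℚ 0 + t)) v₀₀ ⟨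
  1ℚ * (toℚ 0 + v 0 0)    ∎
∑-permutations-classes {n = suc n} {w} {v} mean w-medium v₀₀ k k-w F F-[] F-step cs = begin
  ∑ (permutations cs) (toℚ ∘ F)
    ≡⟨ F-step cs ⟩
  ∑ (picks cs) (λ (c , cs′) → ∑ (permutations cs′) (λ ρ → toℚ (k c (♯ small cs′) (♯ large cs′) ℕ.+ F ρ)))
    ≡⟨ ∑-cong-All (All.zipWith (λ {(c , cs′)} → λ (eq , eq′) → step c cs′ eq eq′) (picks-total (δ small) cs ,
         All.zipWith (λ (eq , eq′) → eq , eq′) (picks-total (δ medium) cs , picks-total (δ large) cs))) ⟩
  ∑ (picks cs) (λ (c , cs′) → toℚ (n !) * (D + g c (♯ small cs′) (♯ large cs′)))
    ≡⟨ *-distribˡ-∑ (toℚ (n !)) (picks cs) ⟨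
  toℚ (n !) * ∑ (picks cs) (λ (c , cs′) → D + g c (♯ small cs′) (♯ large cs′))
    ≡⟨ cong (toℚ (n !) *_) (∑-distrib-+ (picks cs)) ⟩
  toℚ (n !) * (∑ (picks cs) (const D) + ∑ (picks cs) (λ (c , cs′) → g c (♯ small cs′) (♯ large cs′)))
    ≡⟨ cong (toℚ (n !) *_) (cong₂ _+_ (∑-picks-const cs D) average) ⟩
  toℚ (n !) * (toℚ (suc n) * D + toℚ (suc n) * v s l)
    ≡⟨ factor (toℚ (n !)) (toℚ (suc n)) D (v s l) ⟩
  toℚ (suc n) * toℚ (n !) * (D + v s l)
    ≡⟨ cong (_* (D + v s l)) (toℚ-* (suc n) (n !)) ⟨
  toℚ (suc n !) * (D + v s l) ∎
  where
  s m l : ℕ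
  s = ♯ small cs
  m = ♯ medium cs
  l = ♯ large cs

  D : ℚ
  D = toℚ (suc n ℕ.+ (m ℕ.+ s ⊓ l))

  g : Class → ℕ → ℕ → ℚ
  g c i j = w c i j + v i j

  factor : ∀ a b x y → a * (b * x + b * y) ≡ b * a * (x + y)
  factor = solve-∀ ℚ-ring

  average : ∑ (picks cs) (λ (c , cs′) → g c (♯ small cs′) (♯ large cs′)) ≡ toℚ (suc n) * v s l
  average = begin
    ∑ (picks cs) (λ (c , cs′) → g c (♯ small cs′) (♯ large cs′))
      ≡⟨ ∑-picks-classes cs g ⟩
    toℚ s * g small (pred s) l + toℚ m * (w medium s l + v s l) + toℚ l * g large s (pred l)
      ≡⟨ cong (λ t → toℚ s * g small (pred s) l + toℚ m * (t + v s l) + toℚ l * g large s (pred l)) (w-medium s l) ⟩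
    toℚ s * g small (pred s) l + toℚ m * (0ℚ + v s l) + toℚ l * g large s (pred l)
      ≡⟨ regroup (toℚ s * g small (pred s) l) (toℚ m) (v s l) (toℚ l * g large s (pred l)) ⟩
    toℚ s * g small (pred s) l + toℚ l * g large s (pred l) + toℚ m * v s l
      ≡⟨ cong (_+ toℚ m * v s l) (mean s l) ⟩
    toℚ (s ℕ.+ l) * v s l + toℚ m * v s l
      ≡⟨ ℚₚ.*-distribʳ-+ (v s l) (toℚ (s ℕ.+ l)) (toℚ m) ⟨
    (toℚ (s ℕ.+ l) + toℚ m) * v s l
      ≡⟨ cong (_* v s l) (toℚ-+ (s ℕ.+ l) m) ⟨
    toℚ (s ℕ.+ l ℕ.+ m) * v s l
      ≡⟨ cong (λ k → toℚ k * v s l) (trans (rotate s l m) (♯-total cs)) ⟩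
    toℚ (suc n) * v s l ∎
    where
    regroup : ∀ a b c d → a + b * (0ℚ + c) + d ≡ a + d + b * c
    regroup = solve-∀ ℚ-ring

    rotate : ∀ a b c → a ℕ.+ b ℕ.+ c ≡ a ℕ.+ c ℕ.+ b
    rotate = ℕ-Solver.solve-∀

  step : ∀ c (cs′ : Vec Class n) → δ small c ℕ.+ ♯ small cs′ ≡ s →
         δ medium c ℕ.+ ♯ medium cs′ ≡ m × δ large c ℕ.+ ♯ large cs′ ≡ l →
         ∑ (permutations cs′) (λ ρ → toℚ (k c (♯ small cs′) (♯ large cs′) ℕ.+ F ρ)) ≡
         toℚ (n !) * (D + g c (♯ small cs′) (♯ large cs′))
  step c cs′ eqs (eqm , eql) = begin
    ∑ (permutations cs′) (λ ρ → toℚ (k c s′ l′ ℕ.+ F ρ))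
      ≡⟨ ∑-cong (permutations cs′) (λ ρ → toℚ-+ (k c s′ l′) (F ρ)) ⟩
    ∑ (permutations cs′) (λ ρ → toℚ (k c s′ l′) + toℚ (F ρ))
      ≡⟨ ∑-distrib-+ (permutations cs′) ⟩
    ∑ (permutations cs′) (const (toℚ (k c s′ l′))) + ∑ (permutations cs′) (toℚ ∘ F)
      ≡⟨ cong₂ _+_ (∑-permutations-const cs′ (toℚ (k c s′ l′))) (∑-permutations-classes mean w-medium v₀₀ k k-w F F-[] F-step cs′) ⟩
    toℚ (n !) * toℚ (k c s′ l′) + toℚ (n !) * (toℚ (n ℕ.+ (m′ ℕ.+ s′ ⊓ l′)) + v s′ l′)
      ≡⟨ collect (toℚ (n !)) (toℚ (k c s′ l′)) (toℚ (n ℕ.+ (m′ ℕ.+ s′ ⊓ l′))) (v s′ l′) ⟩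
    toℚ (n !) * (toℚ (k c s′ l′) + toℚ (n ℕ.+ (m′ ℕ.+ s′ ⊓ l′)) + v s′ l′)
      ≡⟨ cong (λ t → toℚ (n !) * (t + v s′ l′)) deterministic ⟩
    toℚ (n !) * (D + w c s′ l′ + v s′ l′)
      ≡⟨ cong (toℚ (n !) *_) (ℚₚ.+-assoc D (w c s′ l′) (v s′ l′)) ⟩
    toℚ (n !) * (D + g c s′ l′) ∎
    where
    s′ m′ l′ : ℕ
    s′ = ♯ small cs′
    m′ = ♯ medium cs′
    l′ = ♯ large cs′

    collect : ∀ a b c d → a * b + a * (c + d) ≡ a * (b + c + d)
    collect = solve-∀ ℚ-ring

    regroup : ∀ k n m t → k ℕ.+ (n ℕ.+ (m ℕ.+ t)) ≡ n ℕ.+ m ℕ.+ (k ℕ.+ t)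
    regroup = ℕ-Solver.solve-∀

    regroup′ : ∀ n m d t → n ℕ.+ m ℕ.+ suc (d ℕ.+ t) ≡ suc n ℕ.+ ((d ℕ.+ m) ℕ.+ t)
    regroup′ = ℕ-Solver.solve-∀

    -- Telescoping: the hypothesis on `k` turns the minimum of the remaining counts into that of the
    -- full counts, so `D` comes out the same whichever `c` was removed.
    deterministic : toℚ (k c s′ l′) + toℚ (n ℕ.+ (m′ ℕ.+ s′ ⊓ l′)) ≡ D + w c s′ l′
    deterministic = begin
      toℚ (k c s′ l′) + toℚ (n ℕ.+ (m′ ℕ.+ s′ ⊓ l′))
        ≡⟨ toℚ-+ (k c s′ l′) _ ⟨
      toℚ (k c s′ l′ ℕ.+ (n ℕ.+ (m′ ℕ.+ s′ ⊓ l′)))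
        ≡⟨ cong toℚ (regroup (k c s′ l′) n m′ (s′ ⊓ l′)) ⟩
      toℚ (n ℕ.+ m′ ℕ.+ (k c s′ l′ ℕ.+ s′ ⊓ l′))
        ≡⟨ toℚ-+ (n ℕ.+ m′) (k c s′ l′ ℕ.+ s′ ⊓ l′) ⟩
      toℚ (n ℕ.+ m′) + toℚ (k c s′ l′ ℕ.+ s′ ⊓ l′)
        ≡⟨ cong (_+_ (toℚ (n ℕ.+ m′))) (k-w c s′ l′) ⟩
      toℚ (n ℕ.+ m′) + (toℚ (suc (δ medium c ℕ.+ (δ small c ℕ.+ s′) ⊓ (δ large c ℕ.+ l′))) + w c s′ l′)
        ≡⟨ ℚₚ.+-assoc (toℚ (n ℕ.+ m′)) _ (w c s′ l′) ⟨
      toℚ (n ℕ.+ m′) + toℚ (suc (δ medium c ℕ.+ (δ small c ℕ.+ s′) ⊓ (δ large c ℕ.+ l′))) + w c s′ l′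
        ≡⟨ cong (_+ w c s′ l′) (toℚ-+ (n ℕ.+ m′) _) ⟨
      toℚ (n ℕ.+ m′ ℕ.+ suc (δ medium c ℕ.+ (δ small c ℕ.+ s′) ⊓ (δ large c ℕ.+ l′))) + w c s′ l′
        ≡⟨ cong (λ t → toℚ t + w c s′ l′) (regroup′ n m′ (δ medium c) _) ⟩
      toℚ (suc n ℕ.+ ((δ medium c ℕ.+ m′) ℕ.+ (δ small c ℕ.+ s′) ⊓ (δ large c ℕ.+ l′))) + w c s′ l′
        ≡⟨ cong (λ t → toℚ t + w c s′ l′) (cong (suc n ℕ.+_) (cong₂ ℕ._+_ eqm (cong₂ _⊓_ eqs eql))) ⟩
      D + w c s′ l′ ∎

-- The strategies

direction : ℕ → ℕ → Pivot
direction s l = if l ≤ᵇ s then p-first else q-first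

direction-≥ : ∀ {s l} → l ≤ s → direction s l ≡ p-first
direction-≥ {s} {l} l≤s with l ≤ᵇ s | ℕₚ.≤⇒≤ᵇ l≤s
... | true | _ = refl

direction-< : ∀ {s l} → s < l → direction s l ≡ q-first
direction-< {s} {l} s<l with l ≤ᵇ s | ℕₚ.≤ᵇ⇒≤ l s
... | false | _   = refl
... | true  | l≤s = ⊥-elim (ℕₚ.<⇒≱ s<l (l≤s _))

-- The oracle's counts of what is still to come are read off the remaining sequence itself. The cost
-- of the tail then does not depend on what preceded it, as a recursion on the first element
-- requires.
clairvoyantCost : Vec Class n → ℕ
clairvoyantCost []       = 0
clairvoyantCost (c ∷ cs) = cost (direction (♯ small (c ∷ cs)) (♯ large (c ∷ cs))) c ℕ.+ clairvoyantCost cs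

classificationCost-clairvoyant : ∀ s l {i j} (cs : Vec Class n) → s ≡ i ℕ.+ ♯ small cs → l ≡ j ℕ.+ ♯ large cs →
                                 classificationCost (clairvoyant s l) i j cs ≡ clairvoyantCost cs
classificationCost-clairvoyant s l [] _ _ = refl
classificationCost-clairvoyant s l {i} {j} (c ∷ cs) refl refl = lemma c
  where
  recompute : ∀ a b → a ℕ.+ b ∸ a ≡ b
  recompute = ℕₚ.m+n∸m≡n

  lemma : ∀ c → classificationCost (clairvoyant (i ℕ.+ ♯ small (c ∷ cs)) (j ℕ.+ ♯ large (c ∷ cs))) i j (c ∷ cs) ≡ clairvoyantCost (c ∷ cs)
  lemma small rewrite recompute i (suc (♯ small cs)) | recompute j (♯ large cs) =
    cong (cost (direction (suc (♯ small cs)) (♯ large cs)) small ℕ.+_)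
      (classificationCost-clairvoyant _ _ cs (ℕₚ.+-suc i (♯ small cs)) refl)
  lemma medium rewrite recompute i (♯ small cs) | recompute j (♯ large cs) =
    cong (cost (direction (♯ small cs) (♯ large cs)) medium ℕ.+_)
      (classificationCost-clairvoyant _ _ cs refl refl)
  lemma large rewrite recompute i (♯ small cs) | recompute j (suc (♯ large cs)) =
    cong (cost (direction (♯ small cs) (suc (♯ large cs))) large ℕ.+_)
      (classificationCost-clairvoyant _ _ cs refl (ℕₚ.+-suc j (♯ large cs)))

countCost : Vec Class n → ℕ
countCost = classificationCost direction 0 0

-- Costs are additive, and the pivot for the last element depends on its predecessors only through
-- their numbers of small and large elements.
classificationCost-∷ʳ : ∀ (σ : ℕ → ℕ → Pivot) i j (cs : Vec Class n) c →
  classificationCost σ i j (cs ∷ʳ c) ≡ cost (σ (i ℕ.+ ♯ small cs) (j ℕ.+ ♯ large cs)) c ℕ.+ classificationCost σ i j cs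
classificationCost-∷ʳ σ i j [] c rewrite ℕₚ.+-identityʳ i | ℕₚ.+-identityʳ j = last-step c
  where
  last-step : ∀ c → classificationCost σ i j (c ∷ []) ≡ cost (σ i j) c ℕ.+ 0
  last-step small  = refl
  last-step medium = refl
  last-step large  = refl
classificationCost-∷ʳ σ i j (small  ∷ cs) c
  rewrite classificationCost-∷ʳ σ (suc i) j cs c | ℕₚ.+-suc i (♯ small cs) = +-swap (cost (σ i j) small) (cost (σ (suc (i ℕ.+ ♯ small cs)) (j ℕ.+ ♯ large cs)) c) (classificationCost σ (suc i) j cs)
classificationCost-∷ʳ σ i j (medium ∷ cs) c
  rewrite classificationCost-∷ʳ σ i j cs c = +-swap (cost (σ i j) medium) (cost (σ (i ℕ.+ ♯ small cs) (j ℕ.+ ♯ large cs)) c) (classificationCost σ i j cs)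
classificationCost-∷ʳ σ i j (large  ∷ cs) c
  rewrite classificationCost-∷ʳ σ i (suc j) cs c | ℕₚ.+-suc j (♯ large cs) = +-swap (cost (σ i j) large) (cost (σ (i ℕ.+ ♯ small cs) (suc (j ℕ.+ ♯ large cs))) c) (classificationCost σ i (suc j) cs)

-- The pivot for `c` depends on the order of the rest only through its counts, and by
-- `permutations-total` these agree for all orders.
∑-permutations-clairvoyantCost : ∀ (cs : Vec Class (suc n)) → ∑ (permutations cs) (toℚ ∘ clairvoyantCost) ≡
  ∑ (picks cs) (λ (c , cs′) → ∑ (permutations cs′) λ ρ →
    toℚ (cost (direction (δ small c ℕ.+ ♯ small cs′) (δ large c ℕ.+ ♯ large cs′)) c ℕ.+ clairvoyantCost ρ))
∑-permutations-clairvoyantCost cs = trans (∑-permutations-∷ cs _) (∑-cong (picks cs) λ (c , cs′) →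
  ∑-cong-All (All.zipWith
    (λ {ρ} (eq , eq′) → cong₂ (λ s l → toℚ (cost (direction (δ small c ℕ.+ s) (δ large c ℕ.+ l)) c ℕ.+ clairvoyantCost ρ)) eq eq′)
    (permutations-total (δ small) cs′ , permutations-total (δ large) cs′)))

∑-permutations-countCost : ∀ (cs : Vec Class (suc n)) → ∑ (permutations cs) (toℚ ∘ countCost) ≡
  ∑ (picks cs) (λ (c , cs′) → ∑ (permutations cs′) λ ρ →
    toℚ (cost (direction (♯ small cs′) (♯ large cs′)) c ℕ.+ countCost ρ))
∑-permutations-countCost cs = trans (∑-permutations-∷ʳ cs _) (∑-cong (picks cs) λ (c , cs′) →
  ∑-cong-All (All.zipWith
    (λ {ρ} (eq , eq′) → trans (cong toℚ (classificationCost-∷ʳ direction 0 0 ρ c))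
                              (cong₂ (λ s l → toℚ (cost (direction s l) c ℕ.+ countCost ρ)) eq eq′))
    (permutations-total (δ small) cs′ , permutations-total (δ large) cs′)))

-- Lattice paths

[yes] : ∀ {P : Set} (P? : Dec P) → P → [ P? ] ≡ 1
[yes] (yes _) _ = refl
[yes] (no ¬p) p = ⊥-elim (¬p p)

[no] : ∀ {P : Set} (P? : Dec P) → ¬ P → [ P? ] ≡ 0
[no] (no _)  _  = refl
[no] (yes p) ¬p = ⊥-elim (¬p p)

-- With `s + l = n`, this is the height from which a path of `n` steps reaches 0 by `s` steps down
-- and `l` steps up. Small elements thus correspond to steps down.
height : ℕ → ℕ → ℤ
height s l = + s ℤ.- + l

height-up : ∀ s l → height s l ℤ.+ 1ℤ ≡ height (suc s) l
height-up s l = identity (+ s) (+ l)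
  where
  identity : ∀ x y → (x ℤ.- y) ℤ.+ 1ℤ ≡ (1ℤ ℤ.+ x) ℤ.- y
  identity = ℤ-Solver.solve-∀

height-up′ : ∀ s l → height s (suc l) ℤ.+ 1ℤ ≡ height s l
height-up′ s l = identity (+ s) (+ l)
  where
  identity : ∀ x y → (x ℤ.- (1ℤ ℤ.+ y)) ℤ.+ 1ℤ ≡ x ℤ.- y
  identity = ℤ-Solver.solve-∀

height-down : ∀ s l → height s l ℤ.+ -1ℤ ≡ height s (suc l)
height-down s l = identity (+ s) (+ l)
  where
  identity : ∀ x y → (x ℤ.- y) ℤ.+ -1ℤ ≡ x ℤ.- (1ℤ ℤ.+ y)
  identity = ℤ-Solver.solve-∀

height-down′ : ∀ s l → height (suc s) l ℤ.+ -1ℤ ≡ height s l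
height-down′ s l = identity (+ s) (+ l)
  where
  identity : ∀ x y → ((1ℤ ℤ.+ x) ℤ.- y) ℤ.+ -1ℤ ≡ x ℤ.- y
  identity = ℤ-Solver.solve-∀

height≡0⇒ : ∀ {s l} → height s l ≡ 0ℤ → s ≡ l
height≡0⇒ {s} {l} eq = ℤₚ.+-injective (ℤₚ.i-j≡0⇒i≡j (+ s) (+ l) eq)

height≡0 : ∀ s → height s s ≡ 0ℤ
height≡0 s = ℤₚ.+-inverseʳ (+ s)

height≡-1 : ∀ s → height s (suc s) ≡ -1ℤ
height≡-1 s = trans (sym (height-down s s)) (cong (ℤ._+ -1ℤ) (height≡0 s))

∑-pathsFrom : ∀ n S F → ∑ (pathsFrom n S) F ≡
  ∑ (stepSequences n) (λ ds → if does (Vec.last (follow S ds) ℤₚ.≟ 0ℤ) then F (follow S ds) else 0ℚ)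
∑-pathsFrom n S F = trans (∑-filter _ (List.map (follow S) (stepSequences n))) (∑-map (follow S) (stepSequences n))

-- Agreement is asked for only on paths `follow S ds`, whose first height is known to be `S`; this
-- is what allows the indicator of the first crossing to be pulled out.
∑-pathsFrom-cong : ∀ n S {F G} → (∀ ds → F (follow S ds) ≡ G (follow S ds)) → ∑ (pathsFrom n S) F ≡ ∑ (pathsFrom n S) G
∑-pathsFrom-cong n S {F} {G} eq = begin
  ∑ (pathsFrom n S) F
    ≡⟨ ∑-pathsFrom n S F ⟩
  ∑ (stepSequences n) (λ ds → if does (Vec.last (follow S ds) ℤₚ.≟ 0ℤ) then F (follow S ds) else 0ℚ)
    ≡⟨ ∑-cong (stepSequences n) (λ ds → cong (if does (Vec.last (follow S ds) ℤₚ.≟ 0ℤ) then_else 0ℚ) (eq ds)) ⟩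
  ∑ (stepSequences n) (λ ds → if does (Vec.last (follow S ds) ℤₚ.≟ 0ℤ) then G (follow S ds) else 0ℚ)
    ≡⟨ ∑-pathsFrom n S G ⟨
  ∑ (pathsFrom n S) G ∎

∑-pathsFrom-suc : ∀ n S F → ∑ (pathsFrom (suc n) S) F ≡
  ∑ (pathsFrom n (S ℤ.+ -1ℤ)) (λ p → F (S ∷ p)) + ∑ (pathsFrom n (S ℤ.+ 1ℤ)) (λ p → F (S ∷ p))
∑-pathsFrom-suc n S F = begin
  ∑ (pathsFrom (suc n) S) F
    ≡⟨ ∑-pathsFrom (suc n) S F ⟩
  ∑ (stepSequences (suc n)) (λ ds → if does (Vec.last (follow S ds) ℤₚ.≟ 0ℤ) then F (follow S ds) else 0ℚ)
    ≡⟨ ∑-concatMap _ (stepSequences n) ⟩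
  ∑ (stepSequences n) (λ ds → G 1ℤ ds + (G -1ℤ ds + 0ℚ))
    ≡⟨ ∑-cong (stepSequences n) (λ ds → simplify (G 1ℤ ds) (G -1ℤ ds)) ⟩
  ∑ (stepSequences n) (λ ds → G -1ℤ ds + G 1ℤ ds)
    ≡⟨ ∑-distrib-+ (stepSequences n) ⟩
  ∑ (stepSequences n) (G -1ℤ) + ∑ (stepSequences n) (G 1ℤ)
    ≡⟨ cong₂ _+_ (∑-pathsFrom n (S ℤ.+ -1ℤ) (λ p → F (S ∷ p))) (∑-pathsFrom n (S ℤ.+ 1ℤ) (λ p → F (S ∷ p))) ⟨
  ∑ (pathsFrom n (S ℤ.+ -1ℤ)) (λ p → F (S ∷ p)) + ∑ (pathsFrom n (S ℤ.+ 1ℤ)) (λ p → F (S ∷ p)) ∎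
  where
  G : ℤ → Vec ℤ n → ℚ
  G d ds = if does (Vec.last (follow (S ℤ.+ d) ds) ℤₚ.≟ 0ℤ) then F (S ∷ follow (S ℤ.+ d) ds) else 0ℚ

  simplify : ∀ x y → x + (y + 0ℚ) ≡ y + x
  simplify = solve-∀ ℚ-ring

∑-pathsFrom-zero-≢ : ∀ {S} F → S ≢ 0ℤ → ∑ (pathsFrom 0 S) F ≡ 0ℚ
∑-pathsFrom-zero-≢ {S} F S≢0 = trans (∑-pathsFrom 0 S F) (trans (ℚₚ.+-identityʳ _) (vanish (S ℤₚ.≟ 0ℤ)))
  where
  vanish : (S≟0 : Dec (S ≡ 0ℤ)) → (if does S≟0 then F (S ∷ []) else 0ℚ) ≡ 0ℚ
  vanish (yes S≡0) = ⊥-elim (S≢0 S≡0)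
  vanish (no  _)   = refl

-- Fewer than `l - s` steps cannot lead from `s - l` up to 0. For `s = 0` this makes the step down
-- contribute nothing.
∑-pathsFrom-low : ∀ n s l F → n ℕ.+ s < l → ∑ (pathsFrom n (height s l)) F ≡ 0ℚ
∑-pathsFrom-low zero    s l F s<l = ∑-pathsFrom-zero-≢ F (λ eq → ℕₚ.<⇒≢ s<l (height≡0⇒ eq))
∑-pathsFrom-low (suc n) s l F lt  = begin
  ∑ (pathsFrom (suc n) (height s l)) F
    ≡⟨ ∑-pathsFrom-suc n (height s l) F ⟩
  ∑ (pathsFrom n (height s l ℤ.+ -1ℤ)) F′ + ∑ (pathsFrom n (height s l ℤ.+ 1ℤ)) F′
    ≡⟨ cong₂ (λ S T → ∑ (pathsFrom n S) F′ + ∑ (pathsFrom n T) F′) (height-down s l) (height-up s l) ⟩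
  ∑ (pathsFrom n (height s (suc l))) F′ + ∑ (pathsFrom n (height (suc s) l)) F′
    ≡⟨ cong₂ _+_ (∑-pathsFrom-low n s (suc l) F′ (ℕₚ.≤-trans (ℕₚ.n≤1+n _) (ℕₚ.m≤n⇒m≤1+n lt)))
                 (∑-pathsFrom-low n (suc s) l F′ (subst (_< l) (sym (ℕₚ.+-suc n s)) lt)) ⟩
  0ℚ ∎
  where
  F′ : Path n → ℚ
  F′ p = F (height s l ∷ p)

∑-pathsFrom-high : ∀ n s l F → n ℕ.+ l < s → ∑ (pathsFrom n (height s l)) F ≡ 0ℚ
∑-pathsFrom-high zero    s l F l<s = ∑-pathsFrom-zero-≢ F (λ eq → ℕₚ.<⇒≢ l<s (sym (height≡0⇒ eq)))
∑-pathsFrom-high (suc n) s l F lt  = begin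
  ∑ (pathsFrom (suc n) (height s l)) F
    ≡⟨ ∑-pathsFrom-suc n (height s l) F ⟩
  ∑ (pathsFrom n (height s l ℤ.+ -1ℤ)) F′ + ∑ (pathsFrom n (height s l ℤ.+ 1ℤ)) F′
    ≡⟨ cong₂ (λ S T → ∑ (pathsFrom n S) F′ + ∑ (pathsFrom n T) F′) (height-down s l) (height-up s l) ⟩
  ∑ (pathsFrom n (height s (suc l))) F′ + ∑ (pathsFrom n (height (suc s) l)) F′
    ≡⟨ cong₂ _+_ (∑-pathsFrom-high n s (suc l) F′ (subst (_< s) (sym (ℕₚ.+-suc n l)) lt))
                 (∑-pathsFrom-high n (suc s) l F′ (ℕₚ.≤-trans (ℕₚ.n≤1+n _) (ℕₚ.m≤n⇒m≤1+n lt))) ⟩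
  0ℚ ∎
  where
  F′ : Path n → ℚ
  F′ p = F (height s l ∷ p)

-- The weight s! l! makes the number of paths from height s - l to 0 equal to (s + l)!.
∑-pathsFrom-down : ∀ n s l → s ℕ.+ l ≡ suc n → ∀ (Φ : Path n → ℚ) x →
  (∀ s′ → s ≡ suc s′ → toℚ (s′ !) * toℚ (l !) * ∑ (pathsFrom n (height s′ l)) Φ ≡ toℚ (n !) * x) →
  toℚ (s !) * toℚ (l !) * ∑ (pathsFrom n (height s l ℤ.+ -1ℤ)) Φ ≡ toℚ s * (toℚ (n !) * x)
∑-pathsFrom-down n zero l refl Φ x _ = begin
  1ℚ * toℚ (l !) * ∑ (pathsFrom n (height 0 l ℤ.+ -1ℤ)) Φ   ≡⟨ cong (λ S → 1ℚ * toℚ (l !) * ∑ (pathsFrom n S) Φ) (height-down 0 l) ⟩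
  1ℚ * toℚ (l !) * ∑ (pathsFrom n (height 0 (suc l))) Φ     ≡⟨ cong (1ℚ * toℚ (l !) *_) (∑-pathsFrom-low n 0 (suc l) Φ n<l) ⟩
  1ℚ * toℚ (l !) * 0ℚ                                       ≡⟨ zeros (toℚ (l !)) (toℚ (n !) * x) ⟩
  0ℚ * (toℚ (n !) * x)                                      ∎
  where
  n<l : n ℕ.+ 0 < suc l
  n<l = subst (_< suc l) (sym (ℕₚ.+-identityʳ n)) (s≤s (ℕₚ.n≤1+n n))

  zeros : ∀ y z → 1ℚ * y * 0ℚ ≡ 0ℚ * z
  zeros = solve-∀ ℚ-ring
∑-pathsFrom-down n (suc s) l _ Φ x hyp = begin
  toℚ (suc s !) * toℚ (l !) * ∑ (pathsFrom n (height (suc s) l ℤ.+ -1ℤ)) Φ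
    ≡⟨ cong₂ (λ t S → t * toℚ (l !) * ∑ (pathsFrom n S) Φ) (toℚ-* (suc s) (s !)) (height-down′ s l) ⟩
  toℚ (suc s) * toℚ (s !) * toℚ (l !) * ∑ (pathsFrom n (height s l)) Φ
    ≡⟨ regroup (toℚ (suc s)) (toℚ (s !)) (toℚ (l !)) _ ⟩
  toℚ (suc s) * (toℚ (s !) * toℚ (l !) * ∑ (pathsFrom n (height s l)) Φ)
    ≡⟨ cong (toℚ (suc s) *_) (hyp s refl) ⟩
  toℚ (suc s) * (toℚ (n !) * x) ∎
  where
  regroup : ∀ a b c d → a * b * c * d ≡ a * (b * c * d)
  regroup = solve-∀ ℚ-ring

∑-pathsFrom-up : ∀ n s l → s ℕ.+ l ≡ suc n → ∀ (Φ : Path n → ℚ) x →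
  (∀ l′ → l ≡ suc l′ → toℚ (s !) * toℚ (l′ !) * ∑ (pathsFrom n (height s l′)) Φ ≡ toℚ (n !) * x) →
  toℚ (s !) * toℚ (l !) * ∑ (pathsFrom n (height s l ℤ.+ 1ℤ)) Φ ≡ toℚ l * (toℚ (n !) * x)
∑-pathsFrom-up n s zero s+0≡1+n Φ x _ = begin
  toℚ (s !) * 1ℚ * ∑ (pathsFrom n (height s 0 ℤ.+ 1ℤ)) Φ    ≡⟨ cong (λ S → toℚ (s !) * 1ℚ * ∑ (pathsFrom n S) Φ) (height-up s 0) ⟩
  toℚ (s !) * 1ℚ * ∑ (pathsFrom n (height (suc s) 0)) Φ     ≡⟨ cong (toℚ (s !) * 1ℚ *_) (∑-pathsFrom-high n (suc s) 0 Φ n<s) ⟩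
  toℚ (s !) * 1ℚ * 0ℚ                                       ≡⟨ zeros (toℚ (s !)) (toℚ (n !) * x) ⟩
  0ℚ * (toℚ (n !) * x)                                      ∎
  where
  n<s : n ℕ.+ 0 < suc s
  n<s = subst₂ (λ i j → i < suc j) (sym (ℕₚ.+-identityʳ n)) (trans (sym s+0≡1+n) (ℕₚ.+-identityʳ s)) (s≤s (ℕₚ.n≤1+n n))

  zeros : ∀ y z → y * 1ℚ * 0ℚ ≡ 0ℚ * z
  zeros = solve-∀ ℚ-ring
∑-pathsFrom-up n s (suc l) _ Φ x hyp = begin
  toℚ (s !) * toℚ (suc l !) * ∑ (pathsFrom n (height s (suc l) ℤ.+ 1ℤ)) Φ
    ≡⟨ cong₂ (λ t S → toℚ (s !) * t * ∑ (pathsFrom n S) Φ) (toℚ-* (suc l) (l !)) (height-up′ s l) ⟩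
  toℚ (s !) * (toℚ (suc l) * toℚ (l !)) * ∑ (pathsFrom n (height s l)) Φ
    ≡⟨ regroup (toℚ (s !)) (toℚ (suc l)) (toℚ (l !)) _ ⟩
  toℚ (suc l) * (toℚ (s !) * toℚ (l !) * ∑ (pathsFrom n (height s l)) Φ)
    ≡⟨ cong (toℚ (suc l) *_) (hyp l refl) ⟩
  toℚ (suc l) * (toℚ (n !) * x) ∎
  where
  regroup : ∀ a b c d → a * (b * c) * d ≡ b * (a * c * d)
  regroup = solve-∀ ℚ-ring

toℚ-suc! : ∀ n → toℚ (suc n !) ≡ toℚ (suc n) * toℚ (n !)
toℚ-suc! n = toℚ-* (suc n) (n !)

-- Pascal's rule in weighted form: a first step down contributes `s · n!` and a first step up
-- `l · n!`, together `(n + 1)!`.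
∑-pathsFrom-const : ∀ n s l → s ℕ.+ l ≡ n → toℚ (s !) * toℚ (l !) * ∑ (pathsFrom n (height s l)) (const 1ℚ) ≡ toℚ (n !)
∑-pathsFrom-const zero    zero zero refl = refl
∑-pathsFrom-const (suc n) s    l    eq   = begin
  q * ∑ (pathsFrom (suc n) (height s l)) (const 1ℚ)
    ≡⟨ cong (q *_) (∑-pathsFrom-suc n (height s l) (const 1ℚ)) ⟩
  q * (∑ (pathsFrom n (height s l ℤ.+ -1ℤ)) (const 1ℚ) + ∑ (pathsFrom n (height s l ℤ.+ 1ℤ)) (const 1ℚ))
    ≡⟨ ℚₚ.*-distribˡ-+ q _ _ ⟩
  q * ∑ (pathsFrom n (height s l ℤ.+ -1ℤ)) (const 1ℚ) + q * ∑ (pathsFrom n (height s l ℤ.+ 1ℤ)) (const 1ℚ)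
    ≡⟨ cong₂ _+_
         (∑-pathsFrom-down n s l eq (const 1ℚ) 1ℚ λ { s′ refl →
           trans (∑-pathsFrom-const n s′ l (ℕₚ.suc-injective eq)) (sym (ℚₚ.*-identityʳ _)) })
         (∑-pathsFrom-up n s l eq (const 1ℚ) 1ℚ λ { l′ refl →
           trans (∑-pathsFrom-const n s l′ (ℕₚ.suc-injective (trans (sym (ℕₚ.+-suc s l′)) eq))) (sym (ℚₚ.*-identityʳ _)) }) ⟩
  toℚ s * (toℚ (n !) * 1ℚ) + toℚ l * (toℚ (n !) * 1ℚ)
    ≡⟨ factor (toℚ s) (toℚ l) (toℚ (n !)) ⟩
  (toℚ s + toℚ l) * toℚ (n !)
    ≡⟨ cong (_* toℚ (n !)) (toℚ-+ s l) ⟨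
  toℚ (s ℕ.+ l) * toℚ (n !)
    ≡⟨ cong (λ k → toℚ k * toℚ (n !)) eq ⟩
  toℚ (suc n) * toℚ (n !)
    ≡⟨ toℚ-suc! n ⟨
  toℚ (suc n !) ∎
  where
  q : ℚ
  q = toℚ (s !) * toℚ (l !)

  factor : ∀ a b c → a * (c * 1ℚ) + b * (c * 1ℚ) ≡ (a + b) * c
  factor = solve-∀ ℚ-ring

module Occurrences (a b : ℤ) where

  -- The contribution to occurrences a b of the step ending at height s - l.
  ω : Class → ℕ → ℕ → ℕ
  ω small  s l = [ (height (suc s) l ℤₚ.≟ a) ×-dec (height s l ℤₚ.≟ b) ]
  ω medium s l = 0
  ω large  s l = [ (height s (suc l) ℤₚ.≟ a) ×-dec (height s l ℤₚ.≟ b) ]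

  mean : ∀ n → ℤ → ℚ
  mean n S = 𝔼[ toℚ ∘ occurrences a b ] (uniform (pathsFrom n S))

  μ : ℕ → ℕ → ℚ
  μ s l = mean (s ℕ.+ l) (height s l)

  -- By `∑-pathsFrom-const` the number of paths times `s! l!` is `n!`, so the weighted sum over the
  -- paths is their mean scaled by `n!`.
  ∑-occurrences : ∀ n s l → s ℕ.+ l ≡ n →
    toℚ (s !) * toℚ (l !) * ∑ (pathsFrom n (height s l)) (toℚ ∘ occurrences a b) ≡ toℚ (n !) * mean n (height s l)
  ∑-occurrences n s l eq = begin
    q * ∑ ps (toℚ ∘ occurrences a b)            ≡⟨ cong (q *_) (𝔼-uniform (toℚ ∘ occurrences a b) ps) ⟨
    q * (toℚ (length ps) * v)                   ≡⟨ regroup q (toℚ (length ps)) v ⟩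
    q * (toℚ (length ps) * 1ℚ) * v              ≡⟨ cong (λ t → q * t * v) (∑-const ps 1ℚ) ⟨
    q * ∑ ps (const 1ℚ) * v                     ≡⟨ cong (_* v) (∑-pathsFrom-const n s l eq) ⟩
    toℚ (n !) * v                               ∎
    where
    q v : ℚ
    q = toℚ (s !) * toℚ (l !)
    v = mean n (height s l)

    ps : List (Path n)
    ps = pathsFrom n (height s l)

    regroup : ∀ x y z → x * (y * z) ≡ x * (y * 1ℚ) * z
    regroup = solve-∀ ℚ-ring

  occurrences-follow : ∀ h h′ (ds : Vec ℤ n) →
    occurrences a b (h ∷ follow h′ ds) ≡ [ (h ℤₚ.≟ a) ×-dec (h′ ℤₚ.≟ b) ] ℕ.+ occurrences a b (follow h′ ds)
  occurrences-follow h h′ []       = refl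
  occurrences-follow h h′ (d ∷ ds) = refl

  -- All these paths start at `s - l`, so prepending `h` adds the same indicator to each of them.
  ∑-occurrences-step : ∀ n s l h → s ℕ.+ l ≡ n →
    toℚ (s !) * toℚ (l !) * ∑ (pathsFrom n (height s l)) (λ p → toℚ (occurrences a b (h ∷ p))) ≡
    toℚ (n !) * (toℚ [ (h ℤₚ.≟ a) ×-dec (height s l ℤₚ.≟ b) ] + μ s l)
  ∑-occurrences-step n s l h refl = begin
    q * ∑ ps (λ p → toℚ (occurrences a b (h ∷ p)))
      ≡⟨ cong (q *_) (∑-pathsFrom-cong n (height s l) (λ ds →
           trans (cong toℚ (occurrences-follow h (height s l) ds)) (toℚ-+ e _))) ⟩
    q * ∑ ps (λ p → toℚ e + toℚ (occurrences a b p))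
      ≡⟨ cong (q *_) (∑-distrib-+ ps) ⟩
    q * (∑ ps (const (toℚ e)) + ∑ ps (toℚ ∘ occurrences a b))
      ≡⟨ cong (λ t → q * (t + ∑ ps (toℚ ∘ occurrences a b))) (∑-const ps (toℚ e)) ⟩
    q * (toℚ (length ps) * toℚ e + ∑ ps (toℚ ∘ occurrences a b))
      ≡⟨ regroup q (toℚ (length ps)) (toℚ e) _ ⟩
    q * (toℚ (length ps) * 1ℚ) * toℚ e + q * ∑ ps (toℚ ∘ occurrences a b)
      ≡⟨ cong (λ t → q * t * toℚ e + q * ∑ ps (toℚ ∘ occurrences a b)) (∑-const ps 1ℚ) ⟨
    q * ∑ ps (const 1ℚ) * toℚ e + q * ∑ ps (toℚ ∘ occurrences a b)
      ≡⟨ cong₂ (λ t u → t * toℚ e + u) (∑-pathsFrom-const n s l refl) (∑-occurrences n s l refl) ⟩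
    toℚ (n !) * toℚ e + toℚ (n !) * μ s l
      ≡⟨ ℚₚ.*-distribˡ-+ (toℚ (n !)) (toℚ e) (μ s l) ⟨
    toℚ (n !) * (toℚ e + μ s l) ∎
    where
    q : ℚ
    q = toℚ (s !) * toℚ (l !)

    e : ℕ
    e = [ (h ℤₚ.≟ a) ×-dec (height s l ℤₚ.≟ b) ]

    ps : List (Path n)
    ps = pathsFrom n (height s l)

    regroup : ∀ x y z w → x * (y * z + w) ≡ x * (y * 1ℚ) * z + x * w
    regroup = solve-∀ ℚ-ring

  -- Conditioning on the first step: after weighting, the paths that begin downwards amount to
  -- `s · n!` and those that begin upwards to `l · n!`, and the rest is again a uniform path to 0.
  -- The factor `n!` common to both sides is cancelled.
  μ-isWalkMean : IsWalkMean (λ c s l → toℚ (ω c s l)) μ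
  μ-isWalkMean s l = helper (s ℕ.+ l) refl
    where
    -- The length is abstracted as `n` because `s + l` does not reduce to a successor for variable
    -- `s`. For `n = 0` all weights vanish.
    helper : ∀ n → s ℕ.+ l ≡ n →
             toℚ s * (toℚ (ω small (pred s) l) + μ (pred s) l) + toℚ l * (toℚ (ω large s (pred l)) + μ s (pred l)) ≡ toℚ (s ℕ.+ l) * μ s l
    helper zero eq with refl ← ℕₚ.m+n≡0⇒m≡0 s eq | refl ← ℕₚ.m+n≡0⇒n≡0 s eq =
      zeros (toℚ (ω small 0 0) + μ 0 0) (toℚ (ω large 0 0) + μ 0 0) (μ 0 0)
      where
      zeros : ∀ x y z → 0ℚ * x + 0ℚ * y ≡ 0ℚ * z
      zeros = solve-∀ ℚ-ring
    helper (suc n) eq = toℚ-*-cancelˡ (n !) {{ n ℕₚ.!≢0 }} (begin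
      toℚ (n !) * (toℚ s * x + toℚ l * y)
        ≡⟨ regroup (toℚ (n !)) (toℚ s) x (toℚ l) y ⟩
      toℚ s * (toℚ (n !) * x) + toℚ l * (toℚ (n !) * y)
        ≡⟨ cong₂ _+_
             (∑-pathsFrom-down n s l eq Φ x λ { s′ refl → ∑-occurrences-step n s′ l (height s l) (ℕₚ.suc-injective eq) })
             (∑-pathsFrom-up n s l eq Φ y λ { l′ refl → ∑-occurrences-step n s l′ (height s l) (ℕₚ.suc-injective (trans (sym (ℕₚ.+-suc s l′)) eq)) }) ⟨
      q * ∑ (pathsFrom n (height s l ℤ.+ -1ℤ)) Φ + q * ∑ (pathsFrom n (height s l ℤ.+ 1ℤ)) Φ
        ≡⟨ ℚₚ.*-distribˡ-+ q _ _ ⟨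
      q * (∑ (pathsFrom n (height s l ℤ.+ -1ℤ)) Φ + ∑ (pathsFrom n (height s l ℤ.+ 1ℤ)) Φ)
        ≡⟨ cong (q *_) (∑-pathsFrom-suc n (height s l) (toℚ ∘ occurrences a b)) ⟨
      q * ∑ (pathsFrom (suc n) (height s l)) (toℚ ∘ occurrences a b)
        ≡⟨ ∑-occurrences (suc n) s l eq ⟩
      toℚ (suc n !) * mean (suc n) (height s l)
        ≡⟨ cong (_* mean (suc n) (height s l)) (toℚ-suc! n) ⟩
      toℚ (suc n) * toℚ (n !) * mean (suc n) (height s l)
        ≡⟨ rotate (toℚ (suc n)) (toℚ (n !)) (mean (suc n) (height s l)) ⟩
      toℚ (n !) * (toℚ (suc n) * mean (suc n) (height s l))
        ≡⟨ cong (λ k → toℚ (n !) * (toℚ k * mean k (height s l))) eq ⟨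
      toℚ (n !) * (toℚ (s ℕ.+ l) * μ s l) ∎)
      where
      q x y : ℚ
      q = toℚ (s !) * toℚ (l !)
      x = toℚ (ω small (pred s) l) + μ (pred s) l
      y = toℚ (ω large s (pred l)) + μ s (pred l)

      Φ : Path n → ℚ
      Φ p = toℚ (occurrences a b (height s l ∷ p))

      regroup : ∀ f s x l y → f * (s * x + l * y) ≡ s * (f * x) + l * (f * y)
      regroup = solve-∀ ℚ-ring

      rotate : ∀ x y z → x * y * z ≡ y * (x * z)
      rotate = solve-∀ ℚ-ring

  μ₀₀ : μ 0 0 ≡ 0ℚ
  μ₀₀ = refl

-- Cost of one classification, with min(s, l) as potential

module Down = Occurrences 0ℤ -1ℤ
module Up   = Occurrences -1ℤ 0ℤ

height≡-1⇒ : ∀ {s l} → height s l ≡ -1ℤ → suc s ≡ l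
height≡-1⇒ {s} {l} eq = height≡0⇒ (trans (sym (height-up s l)) (cong (ℤ._+ 1ℤ) eq))

cost-medium : ∀ d → cost d medium ≡ 2
cost-medium p-first = refl
cost-medium q-first = refl

-- Here `s` and `l` are the counts after `c` has gone. The exceptional case is a tie `suc s ≡ l`
-- before a small element: the minimum drops, yet the tie rule picks `p` and one comparison is
-- enough. A large element moves upwards and cannot step from 0 to -1. The crossing stands on the
-- left to keep the identity in ℕ.
clairvoyant-step : ∀ c s l →
  cost (direction (δ small c ℕ.+ s) (δ large c ℕ.+ l)) c ℕ.+ s ⊓ l ℕ.+ Down.ω c s l ≡
  suc (δ medium c ℕ.+ (δ small c ℕ.+ s) ⊓ (δ large c ℕ.+ l))
clairvoyant-step small s l with ℕₚ.<-cmp (suc s) l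
... | tri< 1+s<l 1+s≢l _ = begin
  cost (direction (suc s) l) small ℕ.+ s ⊓ l ℕ.+ Down.ω small s l
    ≡⟨ cong₂ ℕ._+_ (cong₂ ℕ._+_ (cong (λ d → cost d small) (direction-< 1+s<l)) (ℕₚ.m≤n⇒m⊓n≡m (ℕₚ.<⇒≤ (ℕₚ.<⇒≤ 1+s<l))))
                   ([no] ((height (suc s) l ℤₚ.≟ 0ℤ) ×-dec (height s l ℤₚ.≟ -1ℤ)) (λ (eq , _) → 1+s≢l (height≡0⇒ {suc s} {l} eq))) ⟩
  2 ℕ.+ s ℕ.+ 0              ≡⟨ ℕₚ.+-identityʳ (2 ℕ.+ s) ⟩
  suc (suc s)                ≡⟨ cong suc (ℕₚ.m≤n⇒m⊓n≡m (ℕₚ.<⇒≤ 1+s<l)) ⟨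
  suc (suc s ⊓ l)            ∎
... | tri≈ _ refl _ = begin
  cost (direction l l) small ℕ.+ s ⊓ l ℕ.+ Down.ω small s l
    ≡⟨ cong₂ ℕ._+_ (cong₂ ℕ._+_ (cong (λ d → cost d small) (direction-≥ {l} ℕₚ.≤-refl)) (ℕₚ.m≤n⇒m⊓n≡m (ℕₚ.n≤1+n s)))
                   ([yes] ((height l l ℤₚ.≟ 0ℤ) ×-dec (height s l ℤₚ.≟ -1ℤ)) (height≡0 l , height≡-1 s)) ⟩
  1 ℕ.+ s ℕ.+ 1              ≡⟨ ℕₚ.+-comm (1 ℕ.+ s) 1 ⟩
  suc l                      ≡⟨ cong suc (ℕₚ.⊓-idem l) ⟨
  suc (l ⊓ l)                ∎
... | tri> _ 1+s≢l (s≤s l≤s) = begin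
  cost (direction (suc s) l) small ℕ.+ s ⊓ l ℕ.+ Down.ω small s l
    ≡⟨ cong₂ ℕ._+_ (cong₂ ℕ._+_ (cong (λ d → cost d small) (direction-≥ (ℕₚ.m≤n⇒m≤1+n l≤s))) (ℕₚ.m≥n⇒m⊓n≡n l≤s))
                   ([no] ((height (suc s) l ℤₚ.≟ 0ℤ) ×-dec (height s l ℤₚ.≟ -1ℤ)) (λ (eq , _) → 1+s≢l (height≡0⇒ {suc s} {l} eq))) ⟩
  1 ℕ.+ l ℕ.+ 0              ≡⟨ ℕₚ.+-identityʳ (1 ℕ.+ l) ⟩
  suc l                      ≡⟨ cong suc (ℕₚ.m≥n⇒m⊓n≡n (ℕₚ.m≤n⇒m≤1+n l≤s)) ⟨
  suc (suc s ⊓ l)            ∎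
clairvoyant-step medium s l = trans (ℕₚ.+-identityʳ _) (cong (ℕ._+ s ⊓ l) (cost-medium (direction s l)))
clairvoyant-step large s l = begin
  cost (direction s (suc l)) large ℕ.+ s ⊓ l ℕ.+ Down.ω large s l
    ≡⟨ cong (cost (direction s (suc l)) large ℕ.+ s ⊓ l ℕ.+_)
            ([no] ((height s (suc l) ℤₚ.≟ 0ℤ) ×-dec (height s l ℤₚ.≟ -1ℤ))
                  (λ (eq , eq′) → ℕₚ.<⇒≢ (ℕₚ.m≤n⇒m≤1+n (ℕₚ.n<1+n l)) (sym (subst (λ t → suc t ≡ l) (height≡0⇒ {s} {suc l} eq) (height≡-1⇒ {s} {l} eq′))))) ⟩
  cost (direction s (suc l)) large ℕ.+ s ⊓ l ℕ.+ 0
    ≡⟨ ℕₚ.+-identityʳ _ ⟩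
  cost (direction s (suc l)) large ℕ.+ s ⊓ l
    ≡⟨ by-order (ℕₚ.≤-<-connex s l) ⟩
  suc (s ⊓ suc l) ∎
  where
  by-order : s ≤ l ⊎ l < s → cost (direction s (suc l)) large ℕ.+ s ⊓ l ≡ suc (s ⊓ suc l)
  by-order (inj₁ s≤l) = begin
    cost (direction s (suc l)) large ℕ.+ s ⊓ l  ≡⟨ cong₂ ℕ._+_ (cong (λ d → cost d large) (direction-< (s≤s s≤l))) (ℕₚ.m≤n⇒m⊓n≡m s≤l) ⟩
    suc s                                       ≡⟨ cong suc (ℕₚ.m≤n⇒m⊓n≡m (ℕₚ.m≤n⇒m≤1+n s≤l)) ⟨
    suc (s ⊓ suc l)                             ∎
  by-order (inj₂ l<s) = begin
    cost (direction s (suc l)) large ℕ.+ s ⊓ l  ≡⟨ cong₂ ℕ._+_ (cong (λ d → cost d large) (direction-≥ l<s)) (ℕₚ.m≥n⇒m⊓n≡n (ℕₚ.<⇒≤ l<s)) ⟩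
    suc (suc l)                                 ≡⟨ cong suc (ℕₚ.m≥n⇒m⊓n≡n l<s) ⟨
    suc (s ⊓ suc l)                             ∎

-- Here `s` and `l` count what precedes `c`. At a tie the rule picks `p`, so a large element costs 2
-- although the minimum stays; removing that element again moves the height from -1 to 0.
count-step : ∀ c s l →
  cost (direction s l) c ℕ.+ s ⊓ l ≡
  suc (δ medium c ℕ.+ (δ small c ℕ.+ s) ⊓ (δ large c ℕ.+ l)) ℕ.+ Up.ω c s l
count-step large s l with ℕₚ.<-cmp s l
... | tri< s<l s≢l _ = begin
  cost (direction s l) large ℕ.+ s ⊓ l
    ≡⟨ cong₂ ℕ._+_ (cong (λ d → cost d large) (direction-< s<l)) (ℕₚ.m≤n⇒m⊓n≡m (ℕₚ.<⇒≤ s<l)) ⟩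
  suc s                                     ≡⟨ ℕₚ.+-identityʳ (suc s) ⟨
  suc s ℕ.+ 0
    ≡⟨ cong₂ (λ x y → suc x ℕ.+ y) (ℕₚ.m≤n⇒m⊓n≡m (ℕₚ.m≤n⇒m≤1+n (ℕₚ.<⇒≤ s<l)))
             ([no] ((height s (suc l) ℤₚ.≟ -1ℤ) ×-dec (height s l ℤₚ.≟ 0ℤ)) (λ (_ , eq) → s≢l (height≡0⇒ {s} {l} eq))) ⟨
  suc (s ⊓ suc l) ℕ.+ Up.ω large s l ∎
... | tri≈ _ refl _ = begin
  cost (direction l l) large ℕ.+ l ⊓ l
    ≡⟨ cong₂ ℕ._+_ (cong (λ d → cost d large) (direction-≥ {l} ℕₚ.≤-refl)) (ℕₚ.⊓-idem l) ⟩
  suc (suc l)                               ≡⟨ ℕₚ.+-comm 1 (suc l) ⟩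
  suc l ℕ.+ 1
    ≡⟨ cong₂ (λ x y → suc x ℕ.+ y) (ℕₚ.m≤n⇒m⊓n≡m (ℕₚ.n≤1+n l))
             ([yes] ((height l (suc l) ℤₚ.≟ -1ℤ) ×-dec (height l l ℤₚ.≟ 0ℤ)) (height≡-1 l , height≡0 l)) ⟨
  suc (l ⊓ suc l) ℕ.+ Up.ω large l l ∎
... | tri> _ s≢l l<s = begin
  cost (direction s l) large ℕ.+ s ⊓ l
    ≡⟨ cong₂ ℕ._+_ (cong (λ d → cost d large) (direction-≥ (ℕₚ.<⇒≤ l<s))) (ℕₚ.m≥n⇒m⊓n≡n (ℕₚ.<⇒≤ l<s)) ⟩
  suc (suc l)                               ≡⟨ ℕₚ.+-identityʳ (suc (suc l)) ⟨
  suc (suc l) ℕ.+ 0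
    ≡⟨ cong₂ (λ x y → suc x ℕ.+ y) (ℕₚ.m≥n⇒m⊓n≡n l<s)
             ([no] ((height s (suc l) ℤₚ.≟ -1ℤ) ×-dec (height s l ℤₚ.≟ 0ℤ)) (λ (_ , eq) → s≢l (height≡0⇒ {s} {l} eq))) ⟨
  suc (s ⊓ suc l) ℕ.+ Up.ω large s l ∎
count-step medium s l = trans (cong (ℕ._+ s ⊓ l) (cost-medium (direction s l))) (sym (ℕₚ.+-identityʳ _))
count-step small s l = begin
  cost (direction s l) small ℕ.+ s ⊓ l      ≡⟨ by-order (ℕₚ.≤-<-connex l s) ⟩
  suc (suc s ⊓ l)                           ≡⟨ ℕₚ.+-identityʳ _ ⟨
  suc (suc s ⊓ l) ℕ.+ 0
    ≡⟨ cong (suc (suc s ⊓ l) ℕ.+_)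
            ([no] ((height (suc s) l ℤₚ.≟ -1ℤ) ×-dec (height s l ℤₚ.≟ 0ℤ))
                  (λ (eq , eq′) → ℕₚ.<⇒≢ (ℕₚ.m≤n⇒m≤1+n (ℕₚ.n<1+n s)) (trans (height≡0⇒ {s} {l} eq′) (sym (height≡-1⇒ {suc s} {l} eq))))) ⟨
  suc (suc s ⊓ l) ℕ.+ Up.ω small s l        ∎
  where
  by-order : l ≤ s ⊎ s < l → cost (direction s l) small ℕ.+ s ⊓ l ≡ suc (suc s ⊓ l)
  by-order (inj₁ l≤s) = begin
    cost (direction s l) small ℕ.+ s ⊓ l  ≡⟨ cong₂ ℕ._+_ (cong (λ d → cost d small) (direction-≥ l≤s)) (ℕₚ.m≥n⇒m⊓n≡n l≤s) ⟩
    suc l                                 ≡⟨ cong suc (ℕₚ.m≥n⇒m⊓n≡n (ℕₚ.m≤n⇒m≤1+n l≤s)) ⟨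
    suc (suc s ⊓ l)                       ∎
  by-order (inj₂ s<l) = begin
    cost (direction s l) small ℕ.+ s ⊓ l  ≡⟨ cong₂ ℕ._+_ (cong (λ d → cost d small) (direction-< s<l)) (ℕₚ.m≤n⇒m⊓n≡m (ℕₚ.<⇒≤ s<l)) ⟩
    suc (suc s)                           ≡⟨ cong suc (ℕₚ.m≤n⇒m⊓n≡m s<l) ⟨
    suc (suc s ⊓ l)                       ∎

-- Mean costs over all orders of the elements to be classified

MeanCost : Strategy → (ℕ → ℕ → ℚ) → Set
MeanCost σ v = ∀ {n} (cs : Vec Class n) → let s = ♯ small cs; m = ♯ medium cs; l = ♯ large cs in
  ∑ (permutations cs) (λ ρ → toℚ (classificationCost (σ s l) 0 0 ρ)) ≡
  toℚ (n !) * (toℚ (n ℕ.+ (m ℕ.+ s ⊓ l)) + v s l)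

clairvoyant-meanCost : MeanCost clairvoyant (λ s l → - Down.μ s l)
clairvoyant-meanCost {n} cs = begin
  ∑ (permutations cs) (λ ρ → toℚ (classificationCost (clairvoyant s l) 0 0 ρ))
    ≡⟨ ∑-cong-All (All.zipWith (λ {ρ} (eq , eq′) → cong toℚ (classificationCost-clairvoyant s l ρ (sym eq) (sym eq′)))
         (permutations-total (δ small) cs , permutations-total (δ large) cs)) ⟩
  ∑ (permutations cs) (toℚ ∘ clairvoyantCost)
    ≡⟨ ∑-permutations-classes {w = λ c s l → - toℚ (Down.ω c s l)} {v = λ s l → - Down.μ s l}
         isWalkMean (λ _ _ → refl) (cong -_ Down.μ₀₀)
         (λ c s l → cost (direction (δ small c ℕ.+ s) (δ large c ℕ.+ l)) c) step
         clairvoyantCost refl ∑-permutations-clairvoyantCost cs ⟩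
  toℚ (n !) * (toℚ (n ℕ.+ (♯ medium cs ℕ.+ s ⊓ l)) + - Down.μ s l) ∎
  where
  s l : ℕ
  s = ♯ small cs
  l = ♯ large cs

  isWalkMean : IsWalkMean (λ c s l → - toℚ (Down.ω c s l)) (λ s l → - Down.μ s l)
  isWalkMean s l = trans
    (negate (toℚ s) (toℚ (Down.ω small (pred s) l)) (Down.μ (pred s) l) (toℚ l) (toℚ (Down.ω large s (pred l))) (Down.μ s (pred l)))
    (trans (cong -_ (Down.μ-isWalkMean s l)) (ℚₚ.neg-distribʳ-* (toℚ (s ℕ.+ l)) (Down.μ s l)))
    where
    negate : ∀ x a b y c d → x * (- a + - b) + y * (- c + - d) ≡ - (x * (a + b) + y * (c + d))
    negate = solve-∀ ℚ-ring

  step : ∀ c s l → toℚ (cost (direction (δ small c ℕ.+ s) (δ large c ℕ.+ l)) c ℕ.+ s ⊓ l) ≡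
                   toℚ (suc (δ medium c ℕ.+ (δ small c ℕ.+ s) ⊓ (δ large c ℕ.+ l))) + - toℚ (Down.ω c s l)
  step c s l = begin
    toℚ k                           ≡⟨ cancel (toℚ k) (toℚ w) ⟨
    toℚ k + toℚ w + - toℚ w         ≡⟨ cong (_+ - toℚ w) (toℚ-+ k w) ⟨
    toℚ (k ℕ.+ w) + - toℚ w         ≡⟨ cong (λ t → toℚ t + - toℚ w) (clairvoyant-step c s l) ⟩
    _                               ∎
    where
    k w : ℕ
    k = cost (direction (δ small c ℕ.+ s) (δ large c ℕ.+ l)) c ℕ.+ s ⊓ l
    w = Down.ω c s l

    cancel : ∀ x y → x + y + - y ≡ x
    cancel = solve-∀ ℚ-ring

count-meanCost : MeanCost count Up.μ
count-meanCost cs =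
  ∑-permutations-classes {w = λ c s l → toℚ (Up.ω c s l)} {v = Up.μ}
    Up.μ-isWalkMean (λ _ _ → refl) Up.μ₀₀
    (λ c s l → cost (direction s l) c) (λ c s l → trans (cong toℚ (count-step c s l)) (toℚ-+ (suc (δ medium c ℕ.+ (δ small c ℕ.+ s) ⊓ (δ large c ℕ.+ l))) (Up.ω c s l)))
    -- `count s l` unfolds to `direction` for all `s` and `l`, so the cost in `MeanCost` is
    -- `countCost` by computation.
    countCost refl ∑-permutations-countCost cs

-- Classes of 1, …, n

classify-small : ∀ {p q x} → x < p → classify p q x ≡ small
classify-small {p} {q} {x} x<p with x <ᵇ p | ℕₚ.<ᵇ-reflects-< x p
... | true  | _        = refl
... | false | ofⁿ x≮p = ⊥-elim (x≮p x<p)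

classify-large : ∀ {p q x} → p ≤ x → q < x → classify p q x ≡ large
classify-large {p} {q} {x} p≤x q<x with x <ᵇ p | ℕₚ.<ᵇ-reflects-< x p | q <ᵇ x | ℕₚ.<ᵇ-reflects-< q x
... | true  | ofʸ x<p | _     | _        = ⊥-elim (ℕₚ.<⇒≱ x<p p≤x)
... | false | _       | true  | _        = refl
... | false | _       | false | ofⁿ q≮x = ⊥-elim (q≮x q<x)

classify-medium : ∀ {p q x} → p ≤ x → x ≤ q → classify p q x ≡ medium
classify-medium {p} {q} {x} p≤x x≤q with x <ᵇ p | ℕₚ.<ᵇ-reflects-< x p | q <ᵇ x | ℕₚ.<ᵇ-reflects-< q x
... | true  | ofʸ x<p | _     | _       = ⊥-elim (ℕₚ.<⇒≱ x<p p≤x)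
... | false | _       | true  | ofʸ q<x = ⊥-elim (ℕₚ.<⇒≱ q<x x≤q)
... | false | _       | false | _       = refl

δ-small-≥ : ∀ {p q x} → p ≤ x → δ small (classify p q x) ≡ 0
δ-small-≥ {p} {q} {x} p≤x with ℕₚ.≤-<-connex x q
... | inj₁ x≤q = cong (δ small) (classify-medium p≤x x≤q)
... | inj₂ q<x = cong (δ small) (classify-large p≤x q<x)

δ-large-≤ : ∀ {p q x} → x ≤ q → δ large (classify p q x) ≡ 0
δ-large-≤ {p} {q} {x} x≤q with ℕₚ.≤-<-connex p x
... | inj₁ p≤x = cong (δ large) (classify-medium p≤x x≤q)
... | inj₂ x<p = cong (δ large) (classify-small {q = q} x<p)

total-range-below : ∀ (f : A → ℕ) (g : ℕ → A) n i → i ≤ n →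
  (∀ k → k < i → f (g k) ≡ 1) → (∀ k → i ≤ k → f (g k) ≡ 0) → total f (range g n) ≡ i
total-range-below f g zero    zero    _         _   _    = refl
total-range-below f g (suc n) zero    _         one zero′ =
  cong₂ ℕ._+_ (zero′ 0 z≤n) (total-range-below f (g ∘ suc) n 0 z≤n (λ k ()) (λ k _ → zero′ (suc k) z≤n))
total-range-below f g (suc n) (suc i) (s≤s i≤n) one zero′ =
  cong₂ ℕ._+_ (one 0 (s≤s z≤n))
    (total-range-below f (g ∘ suc) n i i≤n (λ k k<i → one (suc k) (s≤s k<i)) (λ k i≤k → zero′ (suc k) (s≤s i≤k)))

total-range-above : ∀ (f : A → ℕ) (g : ℕ → A) n j →
  (∀ k → j ≤ k → f (g k) ≡ 1) → (∀ k → k < j → f (g k) ≡ 0) → total f (range g n) ≡ n ∸ j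
total-range-above f g zero    j       _   _    = sym (ℕₚ.0∸n≡0 j)
total-range-above f g (suc n) zero    one zero′ =
  cong₂ ℕ._+_ (one 0 z≤n) (total-range-above f (g ∘ suc) n 0 (λ k _ → one (suc k) z≤n) (λ k ()))
total-range-above f g (suc n) (suc j) one zero′ =
  cong₂ ℕ._+_ (zero′ 0 (s≤s z≤n))
    (total-range-above f (g ∘ suc) n j (λ k j≤k → one (suc k) (s≤s j≤k)) (λ k k<j → zero′ (suc k) (s≤s k<j)))

♯-map : ∀ c (f : A → Class) (xs : Vec A n) → ♯ c (Vec.map f xs) ≡ total (δ c ∘ f) xs
♯-map c f xs = cong Vec.sum (sym (Vecₚ.map-∘ (δ c) f xs))

-- The partitioning step

-- Splitting on `ρ` exposes the second constructor, without which `comparisons` does not reduce.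
comparisons-∷-∷ʳ : ∀ σ y (ρ : Vec ℕ n) z → comparisons σ (y ∷ (ρ ∷ʳ z)) ≡
  suc (classificationCost (σ (y ⊓ z ∸ 1) (suc (suc n) ∸ (y ⊔ z))) 0 0 (Vec.map (classify (y ⊓ z) (y ⊔ z)) ρ))
comparisons-∷-∷ʳ σ y []      z = refl
comparisons-∷-∷ʳ {n} σ y (x ∷ ρ) z =
  cong₂ (λ w xs → suc (classificationCost (σ (y ⊓ w ∸ 1) (suc (suc n) ∸ (y ⊔ w))) 0 0 (Vec.map (classify (y ⊓ w) (y ⊔ w)) xs)))
        (Vecₚ.last-∷ʳ z (x ∷ ρ)) (Vecₚ.init-∷ʳ z (x ∷ ρ))

module Partitioning (n′ : ℕ) {σ : Strategy} {v : ℕ → ℕ → ℚ} (mean : MeanCost σ v) where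

  N : ℕ
  N = suc (suc n′)

  -- `suc n′` pays for the comparison of the pivots and one comparison per classified element;
  -- `n′ ∸ (s + l)` is the number of medium elements.
  deterministic : ℕ → ℕ → ℚ
  deterministic s l = toℚ (suc n′ ℕ.+ ((n′ ∸ (s ℕ.+ l)) ℕ.+ s ⊓ l))

  -- The total over the `2 · n′!` inputs whose pivots leave `s` small and `l` large elements.
  Ψ : ℕ → ℕ → ℚ
  Ψ s l = toℚ 2 * toℚ (n′ !) * (deterministic s l + v s l)

  -- The hypothesis says that `y`, `z` and `zs` make up 1, ..., N as far as any total can tell. It
  -- is used with the indicators of small and of large, to which the pivots contribute 0; the sum
  -- over all orders depends on `zs` only through the class counts.
  ∑-comparisons : ∀ i j → i < j → j < N → (zs : Vec ℕ n′) → let y = suc i; z = suc j in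
    (∀ f → f y ℕ.+ (f z ℕ.+ total f zs) ≡ total f (range suc N)) →
    ∑ (permutations zs) (λ ρ → toℚ (comparisons σ (y ∷ (ρ ∷ʳ z))) + toℚ (comparisons σ (z ∷ (ρ ∷ʳ y)))) ≡
    Ψ i (N ∸ z)
  ∑-comparisons i j i<j j<N zs rest = begin
    ∑ (permutations zs) (λ ρ → toℚ (comparisons σ (y ∷ (ρ ∷ʳ z))) + toℚ (comparisons σ (z ∷ (ρ ∷ʳ y))))
      ≡⟨ ∑-cong (permutations zs) (λ ρ → trans (cong₂ (λ a b → toℚ a + toℚ b) (yz ρ) (zy ρ)) (double (C (Vec.map (classify y z) ρ)))) ⟩
    ∑ (permutations zs) (λ ρ → toℚ 2 * (1ℚ + toℚ (C (Vec.map (classify y z) ρ))))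
      ≡⟨ *-distribˡ-∑ (toℚ 2) (permutations zs) ⟨
    toℚ 2 * ∑ (permutations zs) (λ ρ → 1ℚ + toℚ (C (Vec.map (classify y z) ρ)))
      ≡⟨ cong (toℚ 2 *_) (∑-distrib-+ (permutations zs)) ⟩
    toℚ 2 * (∑ (permutations zs) (const 1ℚ) + ∑ (permutations zs) (toℚ ∘ C ∘ Vec.map (classify y z)))
      ≡⟨ cong (toℚ 2 *_) (cong₂ _+_ (∑-permutations-const zs 1ℚ) (∑-permutations-map (classify y z) zs (toℚ ∘ C))) ⟩
    toℚ 2 * (toℚ (n′ !) * 1ℚ + ∑ (permutations cs) (toℚ ∘ C))
      ≡⟨ cong (λ t → toℚ 2 * (toℚ (n′ !) * 1ℚ + t)) sumC ⟩
    toℚ 2 * (toℚ (n′ !) * 1ℚ + toℚ (n′ !) * (toℚ (n′ ℕ.+ ((n′ ∸ (i ℕ.+ l)) ℕ.+ i ⊓ l)) + v i l))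
      ≡⟨ collect (toℚ 2) (toℚ (n′ !)) (toℚ (n′ ℕ.+ ((n′ ∸ (i ℕ.+ l)) ℕ.+ i ⊓ l))) (v i l) ⟩
    toℚ 2 * toℚ (n′ !) * (1ℚ + toℚ (n′ ℕ.+ ((n′ ∸ (i ℕ.+ l)) ℕ.+ i ⊓ l)) + v i l)
      ≡⟨ cong (λ t → toℚ 2 * toℚ (n′ !) * (t + v i l)) (toℚ-suc (n′ ℕ.+ ((n′ ∸ (i ℕ.+ l)) ℕ.+ i ⊓ l))) ⟨
    Ψ i l ∎
    where
    y z l : ℕ
    y = suc i
    z = suc j
    l = N ∸ z

    cs : Vec Class n′
    cs = Vec.map (classify y z) zs

    C : Vec Class n′ → ℕ
    C = classificationCost (σ i l) 0 0

    y≤z : y ≤ z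
    y≤z = s≤s (ℕₚ.<⇒≤ i<j)

    yz : ∀ ρ → comparisons σ (y ∷ (ρ ∷ʳ z)) ≡ suc (C (Vec.map (classify y z) ρ))
    yz ρ = trans (comparisons-∷-∷ʳ σ y ρ z)
      (cong₂ (λ p q → suc (classificationCost (σ (p ∸ 1) (N ∸ q)) 0 0 (Vec.map (classify p q) ρ))) (ℕₚ.m≤n⇒m⊓n≡m y≤z) (ℕₚ.m≤n⇒m⊔n≡n y≤z))

    zy : ∀ ρ → comparisons σ (z ∷ (ρ ∷ʳ y)) ≡ suc (C (Vec.map (classify y z) ρ))
    zy ρ = trans (comparisons-∷-∷ʳ σ z ρ y)
      (cong₂ (λ p q → suc (classificationCost (σ (p ∸ 1) (N ∸ q)) 0 0 (Vec.map (classify p q) ρ))) (ℕₚ.m≥n⇒m⊓n≡n y≤z) (ℕₚ.m≥n⇒m⊔n≡m y≤z))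

    double : ∀ c → toℚ (suc c) + toℚ (suc c) ≡ toℚ 2 * (1ℚ + toℚ c)
    double c = trans (cong₂ _+_ (toℚ-suc c) (toℚ-suc c)) (twice (1ℚ + toℚ c))
      where
      twice : ∀ x → x + x ≡ toℚ 2 * x
      twice = solve-∀ ℚ-ring

    collect : ∀ a b c d → a * (b * 1ℚ + b * (c + d)) ≡ a * b * (1ℚ + c + d)
    collect = solve-∀ ℚ-ring

    ♯small : ♯ small cs ≡ i
    ♯small = begin
      ♯ small cs                               ≡⟨ ♯-map small (classify y z) zs ⟩
      total f zs                               ≡⟨ cong₂ (λ a b → a ℕ.+ (b ℕ.+ total f zs)) (δ-small-≥ {y} {z} {y} ℕₚ.≤-refl) (δ-small-≥ {y} {z} {z} y≤z) ⟨
      f y ℕ.+ (f z ℕ.+ total f zs)             ≡⟨ rest f ⟩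
      total f (range suc N)                    ≡⟨ total-range-below f suc N i (ℕₚ.<⇒≤ (ℕₚ.<-trans i<j j<N))
                                                    (λ k k<i → cong (δ small) (classify-small {y} {z} (s≤s k<i)))
                                                    (λ k i≤k → δ-small-≥ {y} {z} (s≤s i≤k)) ⟩
      i                                        ∎
      where
      f : ℕ → ℕ
      f = δ small ∘ classify y z

    ♯large : ♯ large cs ≡ l
    ♯large = begin
      ♯ large cs                               ≡⟨ ♯-map large (classify y z) zs ⟩
      total f zs                               ≡⟨ cong₂ (λ a b → a ℕ.+ (b ℕ.+ total f zs)) (δ-large-≤ {y} {z} {y} y≤z) (δ-large-≤ {y} {z} {z} ℕₚ.≤-refl) ⟨
      f y ℕ.+ (f z ℕ.+ total f zs)             ≡⟨ rest f ⟩
      total f (range suc N)                    ≡⟨ total-range-above f suc N z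
                                                    (λ k z≤k → cong (δ large) (classify-large {y} {z} (ℕₚ.≤-trans y≤z (ℕₚ.m≤n⇒m≤1+n z≤k)) (s≤s z≤k)))
                                                    (λ k k<z → δ-large-≤ {y} {z} k<z) ⟩
      l                                        ∎
      where
      f : ℕ → ℕ
      f = δ large ∘ classify y z

    -- Obtained as a remainder: a total over `range suc N` would include the two pivots, which
    -- `classify` makes medium.
    ♯medium : ♯ medium cs ≡ n′ ∸ (i ℕ.+ l)
    ♯medium = begin
      ♯ medium cs                                                                ≡⟨ ℕₚ.m+n∸m≡n (♯ small cs ℕ.+ ♯ large cs) (♯ medium cs) ⟨
      ♯ small cs ℕ.+ ♯ large cs ℕ.+ ♯ medium cs ∸ (♯ small cs ℕ.+ ♯ large cs)    ≡⟨ cong₂ _∸_ (trans (rotate (♯ small cs) (♯ large cs) (♯ medium cs)) (♯-total cs)) (cong₂ ℕ._+_ ♯small ♯large) ⟩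
      n′ ∸ (i ℕ.+ l)                                                             ∎
      where
      rotate : ∀ a b c → a ℕ.+ b ℕ.+ c ≡ a ℕ.+ c ℕ.+ b
      rotate = ℕ-Solver.solve-∀

    sumC : ∑ (permutations cs) (toℚ ∘ C) ≡ toℚ (n′ !) * (toℚ (n′ ℕ.+ ((n′ ∸ (i ℕ.+ l)) ℕ.+ i ⊓ l)) + v i l)
    sumC = begin
      ∑ (permutations cs) (λ ρ → toℚ (classificationCost (σ i l) 0 0 ρ))
        ≡⟨ cong₂ (λ s l → ∑ (permutations cs) (λ ρ → toℚ (classificationCost (σ s l) 0 0 ρ))) ♯small ♯large ⟨
      ∑ (permutations cs) (λ ρ → toℚ (classificationCost (σ (♯ small cs) (♯ large cs)) 0 0 ρ))
        ≡⟨ mean cs ⟩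
      toℚ (n′ !) * (toℚ (n′ ℕ.+ (♯ medium cs ℕ.+ ♯ small cs ⊓ ♯ large cs)) + v (♯ small cs) (♯ large cs))
        ≡⟨ cong (λ m → toℚ (n′ !) * (toℚ (n′ ℕ.+ (m ℕ.+ ♯ small cs ⊓ ♯ large cs)) + v (♯ small cs) (♯ large cs))) ♯medium ⟩
      toℚ (n′ !) * (toℚ (n′ ℕ.+ ((n′ ∸ (i ℕ.+ l)) ℕ.+ ♯ small cs ⊓ ♯ large cs)) + v (♯ small cs) (♯ large cs))
        ≡⟨ cong₂ (λ s t → toℚ (n′ !) * (toℚ (n′ ℕ.+ ((n′ ∸ (i ℕ.+ l)) ℕ.+ s ⊓ t)) + v s t)) ♯small ♯large ⟩
      toℚ (n′ !) * (toℚ (n′ ℕ.+ ((n′ ∸ (i ℕ.+ l)) ℕ.+ i ⊓ l)) + v i l) ∎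

  N!*𝔼P : toℚ (N !) * 𝔼 (P σ N) ≡ toℚ 2 * toℚ (n′ !) * (∑< (suc n′) (∑∕ deterministic) + ∑< (suc n′) (∑∕ v))
  N!*𝔼P = begin
    toℚ (N !) * 𝔼 (P σ N)
      ≡⟨ cong₂ _*_ (sym (length-permutations xs)) (trans (𝔼-toℚ (P σ N)) (trans (𝔼->>= toℚ (randomPermutation N) (λ as → return (comparisons σ as)))
           (𝔼-cong (randomPermutation N) (λ as → 𝔼-return toℚ (comparisons σ as))))) ⟩
    toℚ (length (permutations xs)) * 𝔼[ toℚ ∘ comparisons σ ] (uniform (permutations xs))
      ≡⟨ 𝔼-uniform (toℚ ∘ comparisons σ) (permutations xs) ⟩
    ∑ (permutations xs) (toℚ ∘ comparisons σ)
      ≡⟨ ∑-permutations-ends xs (toℚ ∘ comparisons σ) ⟩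
    ∑ (pairs xs) (λ (y , z , zs) → ∑ (permutations zs) (λ ρ → toℚ (comparisons σ (y ∷ (ρ ∷ʳ z))) + toℚ (comparisons σ (z ∷ (ρ ∷ʳ y)))))
      ≡⟨ ∑-cong-All (All.zipWith
           (λ { {_ , _ , zs} ((i , j , i<j , j<N , refl , refl) , rest) → ∑-comparisons i j i<j j<N zs rest })
           -- `pairs-total` speaks about one `f` at a time; `All.tabulate` moves the quantifier over
           -- `f` inside `All`.
           (pairs-range-All suc n′ , All.tabulate (λ {x} x∈ f → All.lookup (pairs-total f xs) x∈))) ⟩
    ∑ (pairs xs) (λ (y , z , _) → Ψ (pred y) (N ∸ z))
      ≡⟨ ∑-pairs-range suc n′ {λ y z → Ψ (pred y) (N ∸ z)} ⟩
    ∑<< N (λ i j → Ψ i (N ∸ suc j))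
      ≡⟨ ∑<<-as-∑∕ N {λ i j → Ψ i (N ∸ suc j)} {Ψ} (λ { i m l refl → cong (Ψ i) (ℕₚ.m+n∸m≡n (i ℕ.+ m) l) }) ⟩
    ∑< (suc n′) (∑∕ Ψ)
      ≡⟨ ∑<-cong (suc n′) (λ k _ → sym (*-distribˡ-∑∕ (toℚ 2 * toℚ (n′ !)) k {λ s l → deterministic s l + v s l})) ⟩
    ∑< (suc n′) (λ k → toℚ 2 * toℚ (n′ !) * ∑∕ (λ s l → deterministic s l + v s l) k)
      ≡⟨ *-distribˡ-∑< (toℚ 2 * toℚ (n′ !)) (suc n′) {∑∕ (λ s l → deterministic s l + v s l)} ⟨
    toℚ 2 * toℚ (n′ !) * ∑< (suc n′) (∑∕ (λ s l → deterministic s l + v s l))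
      ≡⟨ cong (toℚ 2 * toℚ (n′ !) *_) (trans (∑<-cong (suc n′) (λ k _ → ∑∕-distrib-+ k {deterministic} {v})) (∑<-distrib-+ (suc n′) {∑∕ deterministic} {∑∕ v})) ⟩
    toℚ 2 * toℚ (n′ !) * (∑< (suc n′) (∑∕ deterministic) + ∑< (suc n′) (∑∕ v)) ∎
    where
    xs : Vec ℕ N
    xs = range suc N

-- The random lattice path

-- The test is an abstract `b` because the induction shifts both of its arguments by `suc`.
∑<-∑<-filter : ∀ n (b : ℕ → ℕ → Bool) (h : ℕ → ℕ → ℚ) → (∀ i j → i < j → b i j ≡ true) → (∀ i j → j ≤ i → b i j ≡ false) →
               ∑< n (λ i → ∑< n (λ j → if b i j then h i j else 0ℚ)) ≡ ∑<< n h
∑<-∑<-filter zero    b h b-< b-≥ = refl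
∑<-∑<-filter (suc n) b h b-< b-≥ = cong₂ _+_
  (trans (cong₂ (λ t u → (if t then h 0 0 else 0ℚ) + u) (b-≥ 0 0 z≤n)
                (∑<-cong n (λ j _ → cong (if_then h 0 (suc j) else 0ℚ) (b-< 0 (suc j) (s≤s z≤n)))))
         (ℚₚ.+-identityˡ (∑< n (h 0 ∘ suc))))
  (trans (∑<-cong n (λ i _ → trans (cong (λ t → (if t then h (suc i) 0 else 0ℚ) + ∑< n (λ j → if b (suc i) (suc j) then h (suc i) (suc j) else 0ℚ))
                                          (b-≥ (suc i) 0 z≤n))
                                   (ℚₚ.+-identityˡ _)))
         (∑<-∑<-filter n (λ i j → b (suc i) (suc j)) (λ i j → h (suc i) (suc j))
                       (λ i j i<j → b-< (suc i) (suc j) (s≤s i<j)) (λ i j j≤i → b-≥ (suc i) (suc j) (s≤s j≤i))))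

∑-pivotPairs : ∀ n (K : ℕ × ℕ → ℚ) → ∑ (pivotPairs n) K ≡ ∑<< n (λ i j → K (suc i , suc j))
∑-pivotPairs n K = begin
  ∑ (pivotPairs n) K
    ≡⟨ ∑-filter (λ (p , q) → p ℕₚ.<? q) (cartesianProduct 1⋯n 1⋯n) ⟩
  ∑ (cartesianProduct 1⋯n 1⋯n) K′
    ≡⟨ ∑-cartesianProduct 1⋯n 1⋯n ⟩
  ∑ 1⋯n (λ p → ∑ 1⋯n (λ q → K′ (p , q)))
    ≡⟨ ∑-applyUpTo suc n ⟩
  ∑< n (λ i → ∑ 1⋯n (λ q → K′ (suc i , q)))
    ≡⟨ ∑<-cong n (λ i _ → ∑-applyUpTo suc n) ⟩
  ∑< n (λ i → ∑< n (λ j → K′ (suc i , suc j)))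
    ≡⟨ ∑<-∑<-filter n (λ i j → does (suc i ℕₚ.<? suc j)) (λ i j → K (suc i , suc j))
         (λ i j i<j → dec-true (suc i ℕₚ.<? suc j) (s≤s i<j))
         (λ i j j≤i → dec-false (suc i ℕₚ.<? suc j) (λ i<j → ℕₚ.<⇒≱ i<j (s≤s j≤i))) ⟩
  ∑<< n (λ i j → K (suc i , suc j)) ∎
  where
  1⋯n : List ℕ
  1⋯n = applyUpTo suc n

  K′ : ℕ × ℕ → ℚ
  K′ (p , q) = if does (p ℕₚ.<? q) then K (p , q) else 0ℚ

∑<-suc : ∀ n → ∑< n (toℚ ∘ suc) ≡ ½ * (toℚ n * toℚ (suc n))
∑<-suc zero    = refl
∑<-suc (suc n) = begin
  ∑< (suc n) (toℚ ∘ suc)                            ≡⟨ ∑<-last n (toℚ ∘ suc) ⟩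
  ∑< n (toℚ ∘ suc) + toℚ (suc n)                    ≡⟨ cong (_+ toℚ (suc n)) (∑<-suc n) ⟩
  ½ * (toℚ n * toℚ (suc n)) + toℚ (suc n)           ≡⟨ identity (toℚ n) (toℚ (suc n)) ⟩
  ½ * (toℚ (suc n) * (1ℚ + (1ℚ + toℚ n)))           ≡⟨ cong (λ t → ½ * (toℚ (suc n) * t)) (trans (cong (_+_ 1ℚ) (sym (toℚ-suc n))) (sym (toℚ-suc (suc n)))) ⟩
  ½ * (toℚ (suc n) * toℚ (suc (suc n)))             ∎
  where
  identity : ∀ x y → ½ * (x * y) + y ≡ ½ * (y * (1ℚ + (1ℚ + x)))
  identity = solve-∀ ℚ-ring

-- There are `k + 1` pairs that leave `k` elements outside. The count is kept as a sum over `k`, the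
-- common normalising factor of both expectations.
length-pivotPairs : ∀ n → toℚ (length (pivotPairs n)) ≡ ∑< (n ∸ 1) (toℚ ∘ suc)
length-pivotPairs n = begin
  toℚ (length (pivotPairs n))                 ≡⟨ ℚₚ.*-identityʳ _ ⟨
  toℚ (length (pivotPairs n)) * 1ℚ            ≡⟨ ∑-const (pivotPairs n) 1ℚ ⟨
  ∑ (pivotPairs n) (const 1ℚ)                 ≡⟨ ∑-pivotPairs n (const 1ℚ) ⟩
  ∑<< n (λ _ _ → 1ℚ)                          ≡⟨ ∑<<-as-∑∕ n {F = λ _ _ → 1ℚ} (λ _ _ _ _ → refl) ⟩
  ∑< (n ∸ 1) (∑∕ (λ _ _ → 1ℚ))                ≡⟨ ∑<-cong (n ∸ 1) (λ k _ → trans (∑∕-const k 1ℚ) (ℚₚ.*-identityʳ _)) ⟩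
  ∑< (n ∸ 1) (toℚ ∘ suc)                      ∎

module RandomPath (a b : ℤ) where
  open Occurrences a b

  -- The starting height `2 j - n` is `s - l` for `s = j` and `l = n - j`, so a uniform starting
  -- height is a uniform point of the antidiagonal `s + l = n`.
  𝔼-randomPath : ∀ n → toℚ (suc n) * 𝔼[ toℚ ∘ occurrences a b ] (randomPath n) ≡ ∑∕ μ n
  𝔼-randomPath n = begin
    toℚ (suc n) * 𝔼[ toℚ ∘ occurrences a b ] (randomPath n)
      ≡⟨ cong₂ (λ k x → toℚ k * x) (sym (Listₚ.length-applyUpTo start (suc n)))
               (𝔼->>= (toℚ ∘ occurrences a b) (uniform (startingHeights n)) (λ S → uniform (pathsFrom n S))) ⟩
    toℚ (length (startingHeights n)) * 𝔼[ mean n ] (uniform (startingHeights n))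
      ≡⟨ 𝔼-uniform (mean n) (startingHeights n) ⟩
    ∑ (startingHeights n) (mean n)
      ≡⟨ ∑-applyUpTo start (suc n) {mean n} ⟩
    ∑< (suc n) (mean n ∘ start)
      ≡⟨ ∑<-as-∑∕ n {mean n ∘ start} {μ} (λ { s l refl → cong (mean (s ℕ.+ l)) (start-height (+ s) (+ l)) }) ⟩
    ∑∕ μ n ∎
    where
    start : ℕ → ℤ
    start j = + (2 ℕ.* j) ℤ.- + n

    start-height : ∀ x y → (x ℤ.+ (x ℤ.+ 0ℤ)) ℤ.- (x ℤ.+ y) ≡ x ℤ.- y
    start-height = ℤ-Solver.solve-∀

  -- All `k + 1` pivot pairs with `s + l = k` give the same path mean. Their number is the very
  -- factor in `𝔼-randomPath`, so each group becomes one antidiagonal sum of `μ`.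
  𝔼-X : ∀ n → ∑< (n ∸ 1) (toℚ ∘ suc) * 𝔼 (X (occurrences a b) n) ≡ ∑< (n ∸ 1) (∑∕ μ)
  𝔼-X n = begin
    ∑< (n ∸ 1) (toℚ ∘ suc) * 𝔼 (X (occurrences a b) n)
      ≡⟨ cong₂ _*_ (sym (length-pivotPairs n)) (trans (𝔼-toℚ (X (occurrences a b) n)) (trans
           (𝔼->>= toℚ (uniform (pivotPairs n)) (λ (p , q) → randomPath (n ∸ 1 ∸ (q ∸ p)) >>= (λ path → return (occurrences a b path))))
           (𝔼-cong (uniform (pivotPairs n)) (λ (p , q) → trans
             (𝔼->>= toℚ (randomPath (n ∸ 1 ∸ (q ∸ p))) (λ path → return (occurrences a b path)))
             (𝔼-cong (randomPath (n ∸ 1 ∸ (q ∸ p))) (λ path → 𝔼-return toℚ (occurrences a b path))))))) ⟩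
    toℚ (length (pivotPairs n)) * 𝔼[ (λ (p , q) → pathMean (n ∸ 1 ∸ (q ∸ p))) ] (uniform (pivotPairs n))
      ≡⟨ 𝔼-uniform (λ (p , q) → pathMean (n ∸ 1 ∸ (q ∸ p))) (pivotPairs n) ⟩
    ∑ (pivotPairs n) (λ (p , q) → pathMean (n ∸ 1 ∸ (q ∸ p)))
      ≡⟨ ∑-pivotPairs n (λ (p , q) → pathMean (n ∸ 1 ∸ (q ∸ p))) ⟩
    ∑<< n (λ i j → pathMean (n ∸ 1 ∸ (suc j ∸ suc i)))
      ≡⟨ ∑<<-as-∑∕ n {F = λ s l → pathMean (s ℕ.+ l)} (λ { i m l refl → cong pathMean (path-length i m l) }) ⟩
    ∑< (n ∸ 1) (∑∕ (λ s l → pathMean (s ℕ.+ l)))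
      ≡⟨ ∑<-cong (n ∸ 1) (λ k _ → trans
           (∑∕-cong k {λ s l → pathMean (s ℕ.+ l)} {λ _ _ → pathMean k} (λ s l eq → cong pathMean eq))
           (trans (∑∕-const k (pathMean k)) (𝔼-randomPath k))) ⟩
    ∑< (n ∸ 1) (∑∕ μ) ∎
    where
    pathMean : ℕ → ℚ
    pathMean k = 𝔼[ toℚ ∘ occurrences a b ] (randomPath k)

    path-length : ∀ i m l → suc (i ℕ.+ m ℕ.+ l) ∸ (suc (i ℕ.+ m) ∸ i) ≡ i ℕ.+ l
    path-length i m l = begin
      suc (i ℕ.+ m ℕ.+ l) ∸ (suc (i ℕ.+ m) ∸ i)   ≡⟨ cong (λ t → suc (i ℕ.+ m ℕ.+ l) ∸ (t ∸ i)) (ℕₚ.+-suc i m) ⟨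
      suc (i ℕ.+ m ℕ.+ l) ∸ (i ℕ.+ suc m ∸ i)     ≡⟨ cong (suc (i ℕ.+ m ℕ.+ l) ∸_) (ℕₚ.m+n∸m≡n i (suc m)) ⟩
      i ℕ.+ m ℕ.+ l ∸ m                           ≡⟨ cong (_∸ m) (rearrange i m l) ⟩
      m ℕ.+ (i ℕ.+ l) ∸ m                         ≡⟨ ℕₚ.m+n∸m≡n m (i ℕ.+ l) ⟩
      i ℕ.+ l                                     ∎
      where
      rearrange : ∀ a b c → a ℕ.+ b ℕ.+ c ≡ b ℕ.+ (a ℕ.+ c)
      rearrange = ℕ-Solver.solve-∀

-- The deterministic part of the cost

mins : ℕ → ℚ
mins = ∑∕ (λ s l → toℚ (s ⊓ l))

-- The terms with `s = 0` or `l = 0` vanish, and in the `n + 1` others `suc s ⊓ suc l` is one more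
-- than `s ⊓ l`. Hence `mins k` is the integer part of k² / 4.
mins-suc-suc : ∀ n → mins (suc (suc n)) ≡ toℚ (suc n) + mins n
mins-suc-suc n = begin
  0ℚ + ∑∕ (λ s l → toℚ (suc s ⊓ l)) (suc n)
    ≡⟨ ℚₚ.+-identityˡ _ ⟩
  ∑∕ (λ s l → toℚ (suc s ⊓ l)) (suc n)
    ≡⟨ ∑∕-last n (λ s l → toℚ (suc s ⊓ l)) ⟩
  ∑∕ (λ s l → toℚ (suc (s ⊓ l))) n + 0ℚ
    ≡⟨ ℚₚ.+-identityʳ _ ⟩
  ∑∕ (λ s l → toℚ (suc (s ⊓ l))) n
    ≡⟨ ∑∕-cong n (λ s l _ → toℚ-suc (s ⊓ l)) ⟩
  ∑∕ (λ s l → 1ℚ + toℚ (s ⊓ l)) n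
    ≡⟨ ∑∕-distrib-+ n {λ _ _ → 1ℚ} {λ s l → toℚ (s ⊓ l)} ⟩
  ∑∕ (λ _ _ → 1ℚ) n + mins n
    ≡⟨ cong (_+ mins n) (trans (∑∕-const n 1ℚ) (ℚₚ.*-identityʳ (toℚ (suc n)))) ⟩
  toℚ (suc n) + mins n ∎

suc+suc : ∀ j → suc j ℕ.+ suc j ≡ suc (suc (j ℕ.+ j))
suc+suc j = cong suc (ℕₚ.+-suc j j)

mins-even : ∀ j → mins (j ℕ.+ j) ≡ toℚ j * toℚ j
mins-even zero    = refl
mins-even (suc j) = begin
  mins (suc j ℕ.+ suc j)                      ≡⟨ cong mins (suc+suc j) ⟩
  mins (suc (suc (j ℕ.+ j)))                  ≡⟨ mins-suc-suc (j ℕ.+ j) ⟩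
  toℚ (suc j ℕ.+ j) + mins (j ℕ.+ j)          ≡⟨ cong₂ _+_ (trans (toℚ-+ (suc j) j) (cong (_+ toℚ j) (toℚ-suc j))) (mins-even j) ⟩
  1ℚ + toℚ j + toℚ j + toℚ j * toℚ j          ≡⟨ square (toℚ j) ⟩
  (1ℚ + toℚ j) * (1ℚ + toℚ j)                 ≡⟨ cong₂ _*_ (toℚ-suc j) (toℚ-suc j) ⟨
  toℚ (suc j) * toℚ (suc j)                   ∎
  where
  square : ∀ x → 1ℚ + x + x + x * x ≡ (1ℚ + x) * (1ℚ + x)
  square = solve-∀ ℚ-ring

mins-odd : ∀ j → mins (suc (j ℕ.+ j)) ≡ toℚ j * toℚ j + toℚ j
mins-odd zero    = refl
mins-odd (suc j) = begin
  mins (suc (suc j ℕ.+ suc j))                                 ≡⟨ cong (mins ∘ suc) (suc+suc j) ⟩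
  mins (suc (suc (suc (j ℕ.+ j))))                             ≡⟨ mins-suc-suc (suc (j ℕ.+ j)) ⟩
  toℚ (suc (suc (j ℕ.+ j))) + mins (suc (j ℕ.+ j))             ≡⟨ cong₂ (λ k m → toℚ k + m) (sym (suc+suc j)) (mins-odd j) ⟩
  toℚ (suc j ℕ.+ suc j) + (toℚ j * toℚ j + toℚ j)              ≡⟨ cong (_+ (toℚ j * toℚ j + toℚ j)) (trans (toℚ-+ (suc j) (suc j)) (cong₂ _+_ (toℚ-suc j) (toℚ-suc j))) ⟩
  1ℚ + toℚ j + (1ℚ + toℚ j) + (toℚ j * toℚ j + toℚ j)          ≡⟨ identity (toℚ j) ⟩
  (1ℚ + toℚ j) * (1ℚ + toℚ j) + (1ℚ + toℚ j)                   ≡⟨ cong (λ y → y * y + y) (toℚ-suc j) ⟨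
  toℚ (suc j) * toℚ (suc j) + toℚ (suc j)                      ∎
  where
  identity : ∀ x → 1ℚ + x + (1ℚ + x) + (x * x + x) ≡ (1ℚ + x) * (1ℚ + x) + (1ℚ + x)
  identity = solve-∀ ℚ-ring

-- Each step adds two consecutive values, `j²` and `j² + j`. For an odd upper limit `∑<-mins` adds
-- one further `j²`.
∑<-mins-even : ∀ j → let x = toℚ j in ∑< (j ℕ.+ j) mins ≡ (+ 1 / 6) * (x * (x - 1ℚ) * ((+ 4 / 1) * x + 1ℚ))
∑<-mins-even zero    = refl
∑<-mins-even (suc j) = begin
  ∑< (suc j ℕ.+ suc j) mins
    ≡⟨ cong (λ k → ∑< k mins) (suc+suc j) ⟩
  ∑< (suc (suc (j ℕ.+ j))) mins
    ≡⟨ trans (∑<-last (suc (j ℕ.+ j)) mins) (cong (_+ mins (suc (j ℕ.+ j))) (∑<-last (j ℕ.+ j) mins)) ⟩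
  ∑< (j ℕ.+ j) mins + mins (j ℕ.+ j) + mins (suc (j ℕ.+ j))
    ≡⟨ cong₂ _+_ (cong₂ _+_ (∑<-mins-even j) (mins-even j)) (mins-odd j) ⟩
  (+ 1 / 6) * (x * (x - 1ℚ) * ((+ 4 / 1) * x + 1ℚ)) + x * x + (x * x + x)
    ≡⟨ identity x ⟩
  (+ 1 / 6) * ((1ℚ + x) * (1ℚ + x - 1ℚ) * ((+ 4 / 1) * (1ℚ + x) + 1ℚ))
    ≡⟨ cong (λ y → (+ 1 / 6) * (y * (y - 1ℚ) * ((+ 4 / 1) * y + 1ℚ))) (toℚ-suc j) ⟨
  (+ 1 / 6) * (toℚ (suc j) * (toℚ (suc j) - 1ℚ) * ((+ 4 / 1) * toℚ (suc j) + 1ℚ)) ∎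
  where
  x : ℚ
  x = toℚ j

  identity : ∀ x → (+ 1 / 6) * (x * (x - 1ℚ) * ((+ 4 / 1) * x + 1ℚ)) + x * x + (x * x + x) ≡
                   (+ 1 / 6) * ((1ℚ + x) * (1ℚ + x - 1ℚ) * ((+ 4 / 1) * (1ℚ + x) + 1ℚ))
  identity = solve-∀ ℚ-ring

-- Each of the `i + 1` pairs with `s + l = i` has `k - 1 - i` medium elements. The sum is the
-- binomial coefficient `k + 1` over 3; divided by the k (k + 1) / 2 pairs it is (n - 2) / 3 for
-- `n = k + 1`.
∑<-medium : ∀ k → ∑< k (λ i → toℚ (suc i) * toℚ (k ∸ suc i)) ≡ (+ 1 / 6) * ((toℚ k - 1ℚ) * toℚ k * toℚ (suc k))
∑<-medium zero    = refl
∑<-medium (suc k) = begin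
  ∑< (suc k) (λ i → toℚ (suc i) * toℚ (k ∸ i))
    ≡⟨ ∑<-last k (λ i → toℚ (suc i) * toℚ (k ∸ i)) ⟩
  ∑< k (λ i → toℚ (suc i) * toℚ (k ∸ i)) + toℚ (suc k) * toℚ (k ∸ k)
    ≡⟨ cong₂ _+_ (∑<-cong k (λ i i<k → shift i i<k)) (cong (λ t → toℚ (suc k) * toℚ t) (ℕₚ.n∸n≡0 k)) ⟩
  ∑< k (λ i → toℚ (suc i) + toℚ (suc i) * toℚ (k ∸ suc i)) + toℚ (suc k) * 0ℚ
    ≡⟨ cong (_+ toℚ (suc k) * 0ℚ) (∑<-distrib-+ k {toℚ ∘ suc} {λ i → toℚ (suc i) * toℚ (k ∸ suc i)}) ⟩
  ∑< k (toℚ ∘ suc) + ∑< k (λ i → toℚ (suc i) * toℚ (k ∸ suc i)) + toℚ (suc k) * 0ℚ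
    ≡⟨ cong₂ (λ t u → t + u + toℚ (suc k) * 0ℚ) (∑<-suc k) (∑<-medium k) ⟩
  ½ * (toℚ k * toℚ (suc k)) + (+ 1 / 6) * ((toℚ k - 1ℚ) * toℚ k * toℚ (suc k)) + toℚ (suc k) * 0ℚ
    ≡⟨ cong (λ y → ½ * (toℚ k * y) + (+ 1 / 6) * ((toℚ k - 1ℚ) * toℚ k * y) + y * 0ℚ) (toℚ-suc k) ⟩
  ½ * (toℚ k * (1ℚ + toℚ k)) + (+ 1 / 6) * ((toℚ k - 1ℚ) * toℚ k * (1ℚ + toℚ k)) + (1ℚ + toℚ k) * 0ℚ
    ≡⟨ identity (toℚ k) ⟩
  (+ 1 / 6) * ((1ℚ + toℚ k - 1ℚ) * (1ℚ + toℚ k) * (1ℚ + (1ℚ + toℚ k)))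
    ≡⟨ cong (λ y → (+ 1 / 6) * ((y - 1ℚ) * y * (1ℚ + y))) (toℚ-suc k) ⟨
  (+ 1 / 6) * ((toℚ (suc k) - 1ℚ) * toℚ (suc k) * (1ℚ + toℚ (suc k)))
    ≡⟨ cong (λ y → (+ 1 / 6) * ((toℚ (suc k) - 1ℚ) * toℚ (suc k) * y)) (toℚ-suc (suc k)) ⟨
  (+ 1 / 6) * ((toℚ (suc k) - 1ℚ) * toℚ (suc k) * toℚ (suc (suc k))) ∎
  where
  shift : ∀ i → i < k → toℚ (suc i) * toℚ (k ∸ i) ≡ toℚ (suc i) + toℚ (suc i) * toℚ (k ∸ suc i)
  shift i i<k = begin
    toℚ (suc i) * toℚ (k ∸ i)                ≡⟨ cong (λ t → toℚ (suc i) * toℚ t) (ℕₚ.+-∸-assoc 1 i<k) ⟩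
    toℚ (suc i) * toℚ (suc (k ∸ suc i))      ≡⟨ cong (toℚ (suc i) *_) (toℚ-suc (k ∸ suc i)) ⟩
    toℚ (suc i) * (1ℚ + toℚ (k ∸ suc i))     ≡⟨ distribute (toℚ (suc i)) (toℚ (k ∸ suc i)) ⟩
    toℚ (suc i) + toℚ (suc i) * toℚ (k ∸ suc i)  ∎
    where
    distribute : ∀ x y → x * (1ℚ + y) ≡ x + x * y
    distribute = solve-∀ ℚ-ring

  identity : ∀ x → ½ * (x * (1ℚ + x)) + (+ 1 / 6) * ((x - 1ℚ) * x * (1ℚ + x)) + (1ℚ + x) * 0ℚ ≡
                   (+ 1 / 6) * ((1ℚ + x - 1ℚ) * (1ℚ + x) * (1ℚ + (1ℚ + x)))
  identity = solve-∀ ℚ-ring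

data Parity : ℕ → Set where
  even : ∀ j → Parity (j ℕ.+ j)
  odd  : ∀ j → Parity (suc (j ℕ.+ j))

parity : ∀ k → Parity k
parity zero    = even 0
parity (suc k) with parity k
... | even j = odd j
... | odd j  = subst Parity (suc+suc j) (even (suc j))

2∣j+j : ∀ j → 2 ∣ j ℕ.+ j
2∣j+j j = divides j (trans (sym (cong (j ℕ.+_) (ℕₚ.+-identityʳ j))) (ℕₚ.*-comm 2 j))

2∤1+j+j : ∀ j → ¬ 2 ∣ suc (j ℕ.+ j)
2∤1+j+j j 2∣1+j+j with () ← ∣1⇒≡1 (∣m+n∣m⇒∣n (subst (2 ∣_) (ℕₚ.+-comm 1 (j ℕ.+ j)) 2∣1+j+j) (2∣j+j j))

-- With k = n - 1, the term c = 1 / 4(n - [n even]) is characterised by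
-- 4 (2 j + 1) c = 1, where k = 2 j or k = 2 j + 1.
∑<-mins : ∀ n (2≤n : 2 ≤ n) → ∑< (n ∸ 1) mins ≡
  ∑< (n ∸ 1) (toℚ ∘ suc) * ((+ 1 / 6) * toℚ n - (+ 7 / 12) + (+ 1 / (4 ℕ.* (n ∸ [ 2 ∣? n ]))) {{denominator-nonZero 2≤n}})
∑<-mins (suc k) 2≤n = trans (by-parity (parity k) c-inverse) (cong (_* ((+ 1 / 6) * toℚ (suc k) - (+ 7 / 12) + c)) (sym (∑<-suc k)))
  where
  c : ℚ
  c = (+ 1 / (4 ℕ.* (suc k ∸ [ 2 ∣? suc k ]))) {{denominator-nonZero 2≤n}}

  c-inverse : toℚ (4 ℕ.* (suc k ∸ [ 2 ∣? suc k ])) * c ≡ 1ℚ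
  c-inverse = toℚ-inverse (4 ℕ.* (suc k ∸ [ 2 ∣? suc k ])) {{denominator-nonZero 2≤n}}

  toℚ-1+j+j : ∀ j → toℚ (suc (j ℕ.+ j)) ≡ 1ℚ + (toℚ j + toℚ j)
  toℚ-1+j+j j = trans (toℚ-suc (j ℕ.+ j)) (cong (_+_ 1ℚ) (toℚ-+ j j))

  scale : ∀ j d {c} → d ≡ suc (j ℕ.+ j) → toℚ (4 ℕ.* d) * c ≡ 1ℚ → (+ 4 / 1) * (1ℚ + (toℚ j + toℚ j)) * c ≡ 1ℚ
  scale j d {c} refl eq = trans (cong (_* c) (trans (cong ((+ 4 / 1) *_) (sym (toℚ-1+j+j j))) (sym (toℚ-* 4 d)))) eq

  -- Both `k` and `c` are abstracted so that matching on the parity can replace `k` by `j + j` or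
  -- its successor.
  by-parity : ∀ {k c} → Parity k → toℚ (4 ℕ.* (suc k ∸ [ 2 ∣? suc k ])) * c ≡ 1ℚ →
              ∑< k mins ≡ ½ * (toℚ k * toℚ (suc k)) * ((+ 1 / 6) * toℚ (suc k) - (+ 7 / 12) + c)
  by-parity {c = c} (even j) eq = begin
    ∑< (j ℕ.+ j) mins
      ≡⟨ ∑<-mins-even j ⟩
    (+ 1 / 6) * (x * (x - 1ℚ) * ((+ 4 / 1) * x + 1ℚ))
      ≡⟨ identity₁ x ⟩
    ½ * ((x + x) * (1ℚ + (x + x))) * ((+ 1 / 6) * (1ℚ + (x + x)) - (+ 7 / 12)) + (+ 1 / 4) * x * 1ℚ
      -- The remainder `x / 4` has to equal `c` times the number of pairs, x (1 + 2 x). Writing its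
      -- factor 1 as 4 (1 + 2 x) c turns this into a polynomial identity in `x` and `c`.
      ≡⟨ cong (λ t → ½ * ((x + x) * (1ℚ + (x + x))) * ((+ 1 / 6) * (1ℚ + (x + x)) - (+ 7 / 12)) + (+ 1 / 4) * x * t)
              (scale j _ (cong (suc (j ℕ.+ j) ∸_) ([no] (2 ∣? suc (j ℕ.+ j)) (2∤1+j+j j))) eq) ⟨
    ½ * ((x + x) * (1ℚ + (x + x))) * ((+ 1 / 6) * (1ℚ + (x + x)) - (+ 7 / 12)) + (+ 1 / 4) * x * ((+ 4 / 1) * (1ℚ + (x + x)) * c)
      ≡⟨ identity₂ x c ⟩
    ½ * ((x + x) * (1ℚ + (x + x))) * ((+ 1 / 6) * (1ℚ + (x + x)) - (+ 7 / 12) + c)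
      ≡⟨ cong₂ (λ y z → ½ * (y * z) * ((+ 1 / 6) * z - (+ 7 / 12) + c)) (toℚ-+ j j) (toℚ-1+j+j j) ⟨
    ½ * (toℚ (j ℕ.+ j) * toℚ (suc (j ℕ.+ j))) * ((+ 1 / 6) * toℚ (suc (j ℕ.+ j)) - (+ 7 / 12) + c) ∎
    where
    x : ℚ
    x = toℚ j

    identity₁ : ∀ x → (+ 1 / 6) * (x * (x - 1ℚ) * ((+ 4 / 1) * x + 1ℚ)) ≡
                      ½ * ((x + x) * (1ℚ + (x + x))) * ((+ 1 / 6) * (1ℚ + (x + x)) - (+ 7 / 12)) + (+ 1 / 4) * x * 1ℚ
    identity₁ = solve-∀ ℚ-ring

    identity₂ : ∀ x c → ½ * ((x + x) * (1ℚ + (x + x))) * ((+ 1 / 6) * (1ℚ + (x + x)) - (+ 7 / 12)) + (+ 1 / 4) * x * ((+ 4 / 1) * (1ℚ + (x + x)) * c) ≡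
                        ½ * ((x + x) * (1ℚ + (x + x))) * ((+ 1 / 6) * (1ℚ + (x + x)) - (+ 7 / 12) + c)
    identity₂ = solve-∀ ℚ-ring
  by-parity {c = c} (odd j) eq = begin
    ∑< (suc (j ℕ.+ j)) mins
      ≡⟨ ∑<-last (j ℕ.+ j) mins ⟩
    ∑< (j ℕ.+ j) mins + mins (j ℕ.+ j)
      ≡⟨ cong₂ _+_ (∑<-mins-even j) (mins-even j) ⟩
    (+ 1 / 6) * (x * (x - 1ℚ) * ((+ 4 / 1) * x + 1ℚ)) + x * x
      ≡⟨ identity₁ x ⟩
    ½ * ((1ℚ + (x + x)) * (1ℚ + (1ℚ + (x + x)))) * ((+ 1 / 6) * (1ℚ + (1ℚ + (x + x))) - (+ 7 / 12)) + (+ 1 / 4) * (1ℚ + x) * 1ℚ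
      ≡⟨ cong (λ t → ½ * ((1ℚ + (x + x)) * (1ℚ + (1ℚ + (x + x)))) * ((+ 1 / 6) * (1ℚ + (1ℚ + (x + x))) - (+ 7 / 12)) + (+ 1 / 4) * (1ℚ + x) * t)
              (scale j _ (cong (suc (suc (j ℕ.+ j)) ∸_) ([yes] (2 ∣? suc (suc (j ℕ.+ j))) (subst (2 ∣_) (suc+suc j) (2∣j+j (suc j))))) eq) ⟨
    ½ * ((1ℚ + (x + x)) * (1ℚ + (1ℚ + (x + x)))) * ((+ 1 / 6) * (1ℚ + (1ℚ + (x + x))) - (+ 7 / 12)) + (+ 1 / 4) * (1ℚ + x) * ((+ 4 / 1) * (1ℚ + (x + x)) * c)
      ≡⟨ identity₂ x c ⟩
    ½ * ((1ℚ + (x + x)) * (1ℚ + (1ℚ + (x + x)))) * ((+ 1 / 6) * (1ℚ + (1ℚ + (x + x))) - (+ 7 / 12) + c)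
      ≡⟨ cong₂ (λ y z → ½ * (y * z) * ((+ 1 / 6) * z - (+ 7 / 12) + c)) (toℚ-1+j+j j)
               (trans (toℚ-suc (suc (j ℕ.+ j))) (cong (_+_ 1ℚ) (toℚ-1+j+j j))) ⟨
    ½ * (toℚ (suc (j ℕ.+ j)) * toℚ (suc (suc (j ℕ.+ j)))) * ((+ 1 / 6) * toℚ (suc (suc (j ℕ.+ j))) - (+ 7 / 12) + c) ∎
    where
    x : ℚ
    x = toℚ j

    identity₁ : ∀ x → (+ 1 / 6) * (x * (x - 1ℚ) * ((+ 4 / 1) * x + 1ℚ)) + x * x ≡
      ½ * ((1ℚ + (x + x)) * (1ℚ + (1ℚ + (x + x)))) * ((+ 1 / 6) * (1ℚ + (1ℚ + (x + x))) - (+ 7 / 12)) + (+ 1 / 4) * (1ℚ + x) * 1ℚ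
    identity₁ = solve-∀ ℚ-ring

    identity₂ : ∀ x c →
      ½ * ((1ℚ + (x + x)) * (1ℚ + (1ℚ + (x + x)))) * ((+ 1 / 6) * (1ℚ + (1ℚ + (x + x))) - (+ 7 / 12)) + (+ 1 / 4) * (1ℚ + x) * ((+ 4 / 1) * (1ℚ + (x + x)) * c) ≡
      ½ * ((1ℚ + (x + x)) * (1ℚ + (1ℚ + (x + x)))) * ((+ 1 / 6) * (1ℚ + (1ℚ + (x + x))) - (+ 7 / 12) + c)
    identity₂ = solve-∀ ℚ-ring

-- Divided by the number of pairs, the three sums are n - 1, (n - 2) / 3 for the medium elements and
-- n / 6 - 7 / 12 + c for the minimum, together 3 n / 2 - 9 / 4 + c.
∑<-deterministic : ∀ n′ (2≤N : 2 ≤ suc (suc n′)) → let N = suc (suc n′) in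
  ∑< (suc n′) (∑∕ (λ s l → toℚ (suc n′ ℕ.+ ((n′ ∸ (s ℕ.+ l)) ℕ.+ s ⊓ l)))) ≡
  ∑< (suc n′) (toℚ ∘ suc) * ((+ 3 / 2) * toℚ N - (+ 9 / 4) + (+ 1 / (4 ℕ.* (N ∸ [ 2 ∣? N ]))) {{denominator-nonZero 2≤N}})
∑<-deterministic n′ 2≤N = begin
  ∑< k (∑∕ (λ s l → toℚ (k ℕ.+ ((n′ ∸ (s ℕ.+ l)) ℕ.+ s ⊓ l))))
    ≡⟨ ∑<-cong k (λ i _ → antidiagonal i) ⟩
  ∑< k (λ i → toℚ k * toℚ (suc i) + toℚ (suc i) * toℚ (k ∸ suc i) + mins i)
    ≡⟨ trans (∑<-distrib-+ k {λ i → toℚ k * toℚ (suc i) + toℚ (suc i) * toℚ (k ∸ suc i)} {mins})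
             (cong (_+ ∑< k mins) (∑<-distrib-+ k {λ i → toℚ k * toℚ (suc i)} {λ i → toℚ (suc i) * toℚ (k ∸ suc i)})) ⟩
  ∑< k (λ i → toℚ k * toℚ (suc i)) + ∑< k (λ i → toℚ (suc i) * toℚ (k ∸ suc i)) + ∑< k mins
    ≡⟨ cong₂ _+_ (cong₂ _+_ (trans (sym (*-distribˡ-∑< (toℚ k) k {toℚ ∘ suc})) (cong (toℚ k *_) (∑<-suc k))) (∑<-medium k))
                 (trans (∑<-mins N 2≤N) (cong (_* ((+ 1 / 6) * toℚ N - (+ 7 / 12) + c)) (∑<-suc k))) ⟩
  toℚ k * (½ * (toℚ k * toℚ N)) + (+ 1 / 6) * ((toℚ k - 1ℚ) * toℚ k * toℚ N) + ½ * (toℚ k * toℚ N) * ((+ 1 / 6) * toℚ N - (+ 7 / 12) + c)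
    ≡⟨ cong (λ y → toℚ k * (½ * (toℚ k * y)) + (+ 1 / 6) * ((toℚ k - 1ℚ) * toℚ k * y) + ½ * (toℚ k * y) * ((+ 1 / 6) * y - (+ 7 / 12) + c)) (toℚ-suc k) ⟩
  toℚ k * (½ * (toℚ k * (1ℚ + toℚ k))) + (+ 1 / 6) * ((toℚ k - 1ℚ) * toℚ k * (1ℚ + toℚ k)) + ½ * (toℚ k * (1ℚ + toℚ k)) * ((+ 1 / 6) * (1ℚ + toℚ k) - (+ 7 / 12) + c)
    ≡⟨ identity (toℚ k) c ⟩
  ½ * (toℚ k * (1ℚ + toℚ k)) * ((+ 3 / 2) * (1ℚ + toℚ k) - (+ 9 / 4) + c)
    ≡⟨ cong (λ y → ½ * (toℚ k * y) * ((+ 3 / 2) * y - (+ 9 / 4) + c)) (toℚ-suc k) ⟨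
  ½ * (toℚ k * toℚ N) * ((+ 3 / 2) * toℚ N - (+ 9 / 4) + c)
    ≡⟨ cong (_* ((+ 3 / 2) * toℚ N - (+ 9 / 4) + c)) (∑<-suc k) ⟨
  ∑< k (toℚ ∘ suc) * ((+ 3 / 2) * toℚ N - (+ 9 / 4) + c) ∎
  where
  k N : ℕ
  k = suc n′
  N = suc k

  c : ℚ
  c = (+ 1 / (4 ℕ.* (N ∸ [ 2 ∣? N ]))) {{denominator-nonZero 2≤N}}

  antidiagonal : ∀ i → ∑∕ (λ s l → toℚ (k ℕ.+ ((n′ ∸ (s ℕ.+ l)) ℕ.+ s ⊓ l))) i ≡ toℚ k * toℚ (suc i) + toℚ (suc i) * toℚ (k ∸ suc i) + mins i
  antidiagonal i = begin
    ∑∕ (λ s l → toℚ (k ℕ.+ ((n′ ∸ (s ℕ.+ l)) ℕ.+ s ⊓ l))) i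
      ≡⟨ ∑∕-cong i {G = λ s l → toℚ k + toℚ (n′ ∸ i) + toℚ (s ⊓ l)} (λ s l eq →
           trans (cong (λ t → toℚ (k ℕ.+ ((n′ ∸ t) ℕ.+ s ⊓ l))) eq) (split (n′ ∸ i) (s ⊓ l))) ⟩
    ∑∕ (λ s l → toℚ k + toℚ (n′ ∸ i) + toℚ (s ⊓ l)) i
      ≡⟨ ∑∕-distrib-+ i {λ _ _ → toℚ k + toℚ (n′ ∸ i)} {λ s l → toℚ (s ⊓ l)} ⟩
    ∑∕ (λ _ _ → toℚ k + toℚ (n′ ∸ i)) i + mins i
      ≡⟨ cong (_+ mins i) (trans (∑∕-const i (toℚ k + toℚ (n′ ∸ i))) (distribute (toℚ (suc i)) (toℚ k) (toℚ (n′ ∸ i)))) ⟩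
    toℚ k * toℚ (suc i) + toℚ (suc i) * toℚ (n′ ∸ i) + mins i ∎
    where
    split : ∀ a b → toℚ (k ℕ.+ (a ℕ.+ b)) ≡ toℚ k + toℚ a + toℚ b
    split a b = trans (toℚ-+ k (a ℕ.+ b)) (trans (cong (_+_ (toℚ k)) (toℚ-+ a b)) (sym (ℚₚ.+-assoc (toℚ k) (toℚ a) (toℚ b))))

    distribute : ∀ x y z → x * (y + z) ≡ y * x + x * z
    distribute = solve-∀ ℚ-ring

  identity : ∀ x c → x * (½ * (x * (1ℚ + x))) + (+ 1 / 6) * ((x - 1ℚ) * x * (1ℚ + x)) + ½ * (x * (1ℚ + x)) * ((+ 1 / 6) * (1ℚ + x) - (+ 7 / 12) + c) ≡
                     ½ * (x * (1ℚ + x)) * ((+ 3 / 2) * (1ℚ + x) - (+ 9 / 4) + c)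
  identity = solve-∀ ℚ-ring

-- The expected numbers of comparisons

-- There are n (n - 1) / 2 pivot pairs and each occurs in `2 · n′!` inputs, so the normalisations
-- multiply to `n!`, which is cancelled. The second hypothesis identifies `x` as the mean of `v`
-- over the pivot pairs.
𝔼P≡ : ∀ n (2≤n : 2 ≤ n) {σ v x} → MeanCost σ v → ∑< (n ∸ 1) (∑∕ v) ≡ ∑< (n ∸ 1) (toℚ ∘ suc) * x →
  𝔼 (P σ n) ≡ (+ 3 / 2) * toℚ n - (+ 9 / 4) + (+ 1 / (4 ℕ.* (n ∸ [ 2 ∣? n ]))) {{denominator-nonZero 2≤n}} + x
𝔼P≡ 1                 (s≤s ())
𝔼P≡ n@(suc (suc n′)) 2≤n {σ} {v} {x} mean ∑v = toℚ-*-cancelˡ (n !) {{n ℕₚ.!≢0}} (begin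
  toℚ (n !) * 𝔼 (P σ n)
    ≡⟨ Partitioning.N!*𝔼P n′ {σ} {v} mean ⟩
  toℚ 2 * toℚ (n′ !) * (∑< k (∑∕ (λ s l → toℚ (k ℕ.+ ((n′ ∸ (s ℕ.+ l)) ℕ.+ s ⊓ l)))) + ∑< k (∑∕ v))
    ≡⟨ cong (toℚ 2 * toℚ (n′ !) *_) (cong₂ _+_ (∑<-deterministic n′ 2≤n) ∑v) ⟩
  toℚ 2 * toℚ (n′ !) * (∑< k (toℚ ∘ suc) * r + ∑< k (toℚ ∘ suc) * x)
    ≡⟨ cong (λ t → toℚ 2 * toℚ (n′ !) * (t * r + t * x)) (∑<-suc k) ⟩
  toℚ 2 * toℚ (n′ !) * (½ * (toℚ k * toℚ n) * r + ½ * (toℚ k * toℚ n) * x)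
    ≡⟨ identity (toℚ (n′ !)) (toℚ k) (toℚ n) r x ⟩
  toℚ n * (toℚ k * toℚ (n′ !)) * (r + x)
    ≡⟨ cong (_* (r + x)) (trans (toℚ-suc! k) (cong (toℚ n *_) (toℚ-suc! n′))) ⟨
  toℚ (n !) * (r + x) ∎)
  where
  k : ℕ
  k = suc n′

  r : ℚ
  r = (+ 3 / 2) * toℚ n - (+ 9 / 4) + (+ 1 / (4 ℕ.* (n ∸ [ 2 ∣? n ]))) {{denominator-nonZero 2≤n}}

  identity : ∀ a b c r x → toℚ 2 * a * (½ * (b * c) * r + ½ * (b * c) * x) ≡ c * (b * a) * (r + x)
  identity = solve-∀ ℚ-ring

∑<-∑∕-neg : ∀ n F → ∑< n (∑∕ (λ s l → - F s l)) ≡ - ∑< n (∑∕ F)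
∑<-∑∕-neg n F = begin
  ∑< n (∑∕ (λ s l → - F s l))           ≡⟨ ∑<-cong n (λ i _ → ∑∕-cong i (λ s l _ → sym (scale (F s l)))) ⟩
  ∑< n (∑∕ (λ s l → - 1ℚ * F s l))      ≡⟨ ∑<-cong n (λ i _ → sym (*-distribˡ-∑∕ (- 1ℚ) i {F})) ⟩
  ∑< n (λ i → - 1ℚ * ∑∕ F i)            ≡⟨ *-distribˡ-∑< (- 1ℚ) n {∑∕ F} ⟨
  - 1ℚ * ∑< n (∑∕ F)                    ≡⟨ scale (∑< n (∑∕ F)) ⟩
  - ∑< n (∑∕ F)                         ∎
  where
  scale : ∀ x → - 1ℚ * x ≡ - x
  scale = solve-∀ ℚ-ring

lemmaJ1 : (n : ℕ) (2≤n : 2 ≤ n) →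
    (𝔼 (Pᶜᵛ n) ≡ (+ 3 / 2) * toℚ n - (+ 9 / 4) + (+ 1 / (4 ℕ.* (n ∸ [ 2 ∣? n ]))) ⦃ denominator-nonZero 2≤n ⦄ - 𝔼 (X↘ n))
    × (𝔼 (Pᶜᵗ n) ≡ (+ 3 / 2) * toℚ n - (+ 9 / 4) + (+ 1 / (4 ℕ.* (n ∸ [ 2 ∣? n ]))) ⦃ denominator-nonZero 2≤n ⦄ + 𝔼 (X↗ n))
lemmaJ1 n 2≤n =
    𝔼P≡ n 2≤n {clairvoyant} {λ s l → - Down.μ s l} clairvoyant-meanCost (begin
      ∑< (n ∸ 1) (∑∕ (λ s l → - Down.μ s l))      ≡⟨ ∑<-∑∕-neg (n ∸ 1) Down.μ ⟩
      - ∑< (n ∸ 1) (∑∕ Down.μ)                    ≡⟨ cong -_ (RandomPath.𝔼-X 0ℤ -1ℤ n) ⟨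
      - (∑< (n ∸ 1) (toℚ ∘ suc) * 𝔼 (X↘ n))       ≡⟨ ℚₚ.neg-distribʳ-* (∑< (n ∸ 1) (toℚ ∘ suc)) (𝔼 (X↘ n)) ⟩
      ∑< (n ∸ 1) (toℚ ∘ suc) * - 𝔼 (X↘ n)         ∎)
  , 𝔼P≡ n 2≤n {count} {Up.μ} count-meanCost (sym (RandomPath.𝔼-X -1ℤ 0ℤ n))
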